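{- If $T_{opt}$ is an optimal solution of a GGMST instance with $N+1$ non-empty cells, then $$N\le 4\,w(T_{opt})+3.$$
   Context: GGMST (geometric generalized minimum spanning tree problem in grid clusters). The plane $\mathbb{R}^2$ is divided by the integer grid into $1\times 1$ cells $[a,a+1]\times[b,b+1]$, $a,b\in\mathbb{Z}$. An instance is a finite non-empty set $V\subset\mathbb{R}^2$ of points; each point is assigned to exactly one cell containing it (a point on a cell border is assigned to just one of the neighbouring cells, by any rule). A cell is non-empty if at least one point is assigned to it. The edge between two points has weight equal to their Euclidean distance, and the weight $w$ of a graph is the sum of the weights of its edges. A feasible solution is a tree, whose vertices are points of $V$, containing exactly one point from each non-empty cell (so it has $N$ edges when there are $N+1$ non-empty cells). An optimal solution is a feasible solution of minimum weight. -}

module Defs where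

open import Level using (0ℓ)
open import Data.Bool.Base using (if_then_else_)
open import Data.Nat.Base as ℕ using (ℕ; zero; suc)
import Data.Nat.Properties as ℕ
open import Data.Integer.Base as ℤ using (ℤ; +_)
import Data.Integer.Properties as ℤ
import Data.Integer.Solver as ℤ-Solver
open import Data.Rational.Base as ℚ using (ℚ; mkℚ; 0ℚ; 1ℚ; ½)
import Data.Rational.Properties as ℚ
import Data.Rational.Solver as ℚ-Solver
open import Data.Rational.Unnormalised.Base as ℚᵘ using (mkℚᵘ; *≡*; *≤*)
import Data.Rational.Unnormalised.Properties as ℚᵘ
open import Data.Fin.Base as Fin using (Fin)
import Data.Fin.Properties as Fin
open import Data.Fin.Subset using (Subset; _∈_)
open import Data.List.Base
  using (List; []; _∷_; _∷ʳ_; map; foldr; filter; deduplicate; allFin; cartesianProduct)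
open import Data.List.Relation.Unary.Linked using (Linked)
open import Data.List.Relation.Unary.Unique.Propositional using (Unique)
open import Data.Product.Base using (∃; _×_; _,_; proj₁; proj₂; uncurry)
open import Data.Product using (∃!)
import Data.Product.Properties as Product
open import Data.Sum.Base using (inj₁; inj₂)
open import Relation.Nullary using (Dec; ¬_; does; yes; no; _×-dec_)
open import Relation.Binary.Core using (Rel)
open import Relation.Binary.Definitions using (Decidable; DecidableEquality; Symmetric; Irreflexive)
open import Relation.Binary.Construct.Closure.ReflexiveTransitive using (Star)
open import Relation.Binary.PropositionalEquality

record ℝ : Set where
  constructor mkℝ
  field
    seq    : ℕ → ℚ
    cauchy : ∀ ε → 0ℚ ℚ.< ε →
             ∃ λ N → ∀ m n → N ℕ.≤ m → N ℕ.≤ n → ℚ.∣ seq m ℚ.- seq n ∣ ℚ.≤ ε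

open ℝ public

infix 4 _≤_ _≃_

_≤_ : Rel ℝ 0ℓ
x ≤ y = ∀ ε → 0ℚ ℚ.< ε → ∃ λ N → ∀ n → N ℕ.≤ n → seq x n ℚ.≤ seq y n ℚ.+ ε

_≃_ : Rel ℝ 0ℓ
x ≃ y = x ≤ y × y ≤ x

private
  ½*-pos : ∀ {ε} → 0ℚ ℚ.< ε → 0ℚ ℚ.< ½ ℚ.* ε
  ½*-pos {ε} ε>0 = subst (ℚ._< ½ ℚ.* ε) (ℚ.*-zeroʳ ½) (ℚ.*-monoʳ-<-pos ½ ε>0)

  ½*-sum : ∀ ε → ½ ℚ.* ε ℚ.+ ½ ℚ.* ε ≡ ε
  ½*-sum ε = trans (sym (ℚ.*-distribʳ-+ ε ½ ½)) (ℚ.*-identityˡ ε)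

  ≤∣∣ : ∀ p → p ℚ.≤ ℚ.∣ p ∣
  ≤∣∣ p with ℚ.≤-total 0ℚ p
  ... | inj₁ 0≤p = ℚ.≤-reflexive (sym (ℚ.0≤p⇒∣p∣≡p 0≤p))
  ... | inj₂ p≤0 = ℚ.≤-trans p≤0 (ℚ.0≤∣p∣ p)

  ∣-∣≤ : ∀ p q ε → p ℚ.≤ q ℚ.+ ε → q ℚ.≤ p ℚ.+ ε → ℚ.∣ p ℚ.- q ∣ ℚ.≤ ε
  ∣-∣≤ p q ε p≤ q≤ with ℚ.∣p∣≡p∨∣p∣≡-p (p ℚ.- q)
  ... | inj₁ eq = begin
      ℚ.∣ p ℚ.- q ∣        ≡⟨ eq ⟩
      p ℚ.- q              ≤⟨ ℚ.+-monoˡ-≤ (ℚ.- q) p≤ ⟩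
      q ℚ.+ ε ℚ.- q        ≡⟨ solve 2 (λ q ε → q :+ ε :- q := ε) refl q ε ⟩
      ε                    ∎
    where
    open ℚ.≤-Reasoning
    open ℚ-Solver.+-*-Solver
  ... | inj₂ eq = begin
      ℚ.∣ p ℚ.- q ∣        ≡⟨ eq ⟩
      ℚ.- (p ℚ.- q)        ≡⟨ solve 2 (λ p q → :- (p :- q) := q :- p) refl p q ⟩
      q ℚ.- p              ≤⟨ ℚ.+-monoˡ-≤ (ℚ.- p) q≤ ⟩
      p ℚ.+ ε ℚ.- p        ≡⟨ solve 2 (λ q ε → q :+ ε :- q := ε) refl p ε ⟩
      ε                    ∎
    where
    open ℚ.≤-Reasoning
    open ℚ-Solver.+-*-Solver

  ∣-∣≤⁻¹ : ∀ p q ε → ℚ.∣ p ℚ.- q ∣ ℚ.≤ ε → p ℚ.≤ q ℚ.+ ε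
  ∣-∣≤⁻¹ p q ε h = begin
      p                    ≡⟨ solve 2 (λ p q → p := q :+ (p :- q)) refl p q ⟩
      q ℚ.+ (p ℚ.- q)      ≤⟨ ℚ.+-monoʳ-≤ q (≤∣∣ (p ℚ.- q)) ⟩
      q ℚ.+ ℚ.∣ p ℚ.- q ∣  ≤⟨ ℚ.+-monoʳ-≤ q h ⟩
      q ℚ.+ ε              ∎
    where
    open ℚ.≤-Reasoning
    open ℚ-Solver.+-*-Solver

fromℚ : ℚ → ℝ
fromℚ p = mkℝ (λ _ → p) λ ε ε>0 → 0 , λ _ _ _ _ →
  ℚ.≤-trans (ℚ.≤-reflexive (cong ℚ.∣_∣ (ℚ.+-inverseʳ p))) (ℚ.<⇒≤ ε>0)

fromℤ : ℤ → ℝ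
fromℤ z = fromℚ (z ℚ./ 1)

fromℕ : ℕ → ℝ
fromℕ n = fromℤ (+ n)

infixl 6 _+_ _-_
infixl 7 _*_
infix  8 -_

_+_ : ℝ → ℝ → ℝ
x + y = mkℝ (λ n → seq x n ℚ.+ seq y n) λ ε ε>0 →
  let M , x-cauchy = cauchy x (½ ℚ.* ε) (½*-pos ε>0)
      N , y-cauchy = cauchy y (½ ℚ.* ε) (½*-pos ε>0)
  in M ℕ.⊔ N , λ m n m≥ n≥ →
    let open ℚ.≤-Reasoning
        open ℚ-Solver.+-*-Solver
        xm = seq x m ; xn = seq x n ; ym = seq y m ; yn = seq y n
    in begin
      ℚ.∣ xm ℚ.+ ym ℚ.- (xn ℚ.+ yn) ∣
        ≡⟨ cong ℚ.∣_∣ (solve 4 (λ a b c d → a :+ b :- (c :+ d) := (a :- c) :+ (b :- d))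
             refl xm ym xn yn) ⟩
      ℚ.∣ (xm ℚ.- xn) ℚ.+ (ym ℚ.- yn) ∣
        ≤⟨ ℚ.∣p+q∣≤∣p∣+∣q∣ (xm ℚ.- xn) (ym ℚ.- yn) ⟩
      ℚ.∣ xm ℚ.- xn ∣ ℚ.+ ℚ.∣ ym ℚ.- yn ∣
        ≤⟨ ℚ.+-mono-≤ (x-cauchy m n (ℕ.m⊔n≤o⇒m≤o M N m≥) (ℕ.m⊔n≤o⇒m≤o M N n≥))
                      (y-cauchy m n (ℕ.m⊔n≤o⇒n≤o M N m≥) (ℕ.m⊔n≤o⇒n≤o M N n≥)) ⟩
      ½ ℚ.* ε ℚ.+ ½ ℚ.* ε
        ≡⟨ ½*-sum ε ⟩
      ε ∎

-_ : ℝ → ℝ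
- x = mkℝ (λ n → ℚ.- seq x n) λ ε ε>0 →
  let N , x-cauchy = cauchy x ε ε>0
  in N , λ m n m≥ n≥ →
    let open ℚ.≤-Reasoning
        open ℚ-Solver.+-*-Solver
    in begin
      ℚ.∣ ℚ.- seq x m ℚ.- ℚ.- seq x n ∣
        ≡⟨ cong ℚ.∣_∣ (solve 2 (λ a b → :- a :- (:- b) := b :- a) refl (seq x m) (seq x n)) ⟩
      ℚ.∣ seq x n ℚ.- seq x m ∣
        ≤⟨ x-cauchy n m n≥ m≥ ⟩
      ε ∎

_-_ : ℝ → ℝ → ℝ
x - y = x + - y

private
  eventuallyBounded : ∀ x → ∃ λ B → 0ℚ ℚ.< B × ∃ λ N → ∀ n → N ℕ.≤ n → ℚ.∣ seq x n ∣ ℚ.≤ B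
  eventuallyBounded x = b ℚ.+ 1ℚ , b+1>0 , N , bound
    where
    open ℚ.≤-Reasoning
    open ℚ-Solver.+-*-Solver

    N : ℕ
    N = proj₁ (cauchy x 1ℚ (ℚ.positive⁻¹ 1ℚ))

    b : ℚ
    b = ℚ.∣ seq x N ∣

    b+1>0 : 0ℚ ℚ.< b ℚ.+ 1ℚ
    b+1>0 = ℚ.+-mono-≤-< (ℚ.0≤∣p∣ (seq x N)) (ℚ.positive⁻¹ 1ℚ)

    bound : ∀ n → N ℕ.≤ n → ℚ.∣ seq x n ∣ ℚ.≤ b ℚ.+ 1ℚ
    bound n n≥ = begin
      ℚ.∣ seq x n ∣
        ≡⟨ cong ℚ.∣_∣ (solve 2 (λ p q → p := q :+ (p :- q)) refl (seq x n) (seq x N)) ⟩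
      ℚ.∣ seq x N ℚ.+ (seq x n ℚ.- seq x N) ∣
        ≤⟨ ℚ.∣p+q∣≤∣p∣+∣q∣ (seq x N) (seq x n ℚ.- seq x N) ⟩
      b ℚ.+ ℚ.∣ seq x n ℚ.- seq x N ∣
        ≤⟨ ℚ.+-monoʳ-≤ b (proj₂ (cauchy x 1ℚ (ℚ.positive⁻¹ 1ℚ)) n N n≥ ℕ.≤-refl) ⟩
      b ℚ.+ 1ℚ ∎

  divideBy : ∀ {ε B} → 0ℚ ℚ.< ε → 0ℚ ℚ.< B → ∃ λ δ → 0ℚ ℚ.< δ × B ℚ.* δ ≡ ε
  divideBy {ε} {B} ε>0 B>0 =
      B⁻¹ ℚ.* ε
    , subst (ℚ._< B⁻¹ ℚ.* ε) (ℚ.*-zeroʳ B⁻¹)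
        (ℚ.*-monoʳ-<-pos B⁻¹ {{ℚ.1/pos⇒pos B {{ℚ.positive B>0}}}} ε>0)
    , trans (sym (ℚ.*-assoc B B⁻¹ ε))
        (trans (cong (ℚ._* ε) (ℚ.*-inverseʳ B {{B≢0}})) (ℚ.*-identityˡ ε))
    where
    B≢0 = ℚ.pos⇒nonZero B {{ℚ.positive B>0}}
    B⁻¹ = ℚ.1/_ B {{B≢0}}

  ∣*∣≤ : ∀ p q {a b} → ℚ.∣ p ∣ ℚ.≤ a → ℚ.∣ q ∣ ℚ.≤ b → ℚ.∣ p ℚ.* q ∣ ℚ.≤ a ℚ.* b
  ∣*∣≤ p q {a} {b} p≤ q≤ = begin
      ℚ.∣ p ℚ.* q ∣          ≡⟨ ℚ.∣p*q∣≡∣p∣*∣q∣ p q ⟩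
      ℚ.∣ p ∣ ℚ.* ℚ.∣ q ∣    ≤⟨ ℚ.*-monoʳ-≤-nonNeg ℚ.∣ q ∣ {{ℚ.∣-∣-nonNeg q}} p≤ ⟩
      a ℚ.* ℚ.∣ q ∣          ≤⟨ ℚ.*-monoˡ-≤-nonNeg a {{a≥0}} q≤ ⟩
      a ℚ.* b                ∎
    where
    open ℚ.≤-Reasoning
    a≥0 = ℚ.nonNegative (ℚ.≤-trans (ℚ.0≤∣p∣ p) p≤)

_*_ : ℝ → ℝ → ℝ
x * y = mkℝ (λ n → seq x n ℚ.* seq y n) λ ε ε>0 →
  let A , A>0 , K , x-bound = eventuallyBounded x
      B , B>0 , L , y-bound = eventuallyBounded y
      α , α>0 , Aα≡½ε       = divideBy (½*-pos ε>0) A>0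
      β , β>0 , Bβ≡½ε       = divideBy (½*-pos ε>0) B>0
      M , x-cauchy          = cauchy x β β>0
      N , y-cauchy          = cauchy y α α>0
  in (K ℕ.⊔ L) ℕ.⊔ (M ℕ.⊔ N) , λ m n m≥ n≥ →
    let open ℚ.≤-Reasoning
        open ℚ-Solver.+-*-Solver
        xm = seq x m ; xn = seq x n ; ym = seq y m ; yn = seq y n
        m≥KL = ℕ.m⊔n≤o⇒m≤o (K ℕ.⊔ L) (M ℕ.⊔ N) m≥
        m≥MN = ℕ.m⊔n≤o⇒n≤o (K ℕ.⊔ L) (M ℕ.⊔ N) m≥
        n≥KL = ℕ.m⊔n≤o⇒m≤o (K ℕ.⊔ L) (M ℕ.⊔ N) n≥
        n≥MN = ℕ.m⊔n≤o⇒n≤o (K ℕ.⊔ L) (M ℕ.⊔ N) n≥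
    in begin
      ℚ.∣ xm ℚ.* ym ℚ.- xn ℚ.* yn ∣
        ≡⟨ cong ℚ.∣_∣ (solve 4 (λ a b c d → a :* b :- c :* d := a :* (b :- d) :+ d :* (a :- c))
             refl xm ym xn yn) ⟩
      ℚ.∣ xm ℚ.* (ym ℚ.- yn) ℚ.+ yn ℚ.* (xm ℚ.- xn) ∣
        ≤⟨ ℚ.∣p+q∣≤∣p∣+∣q∣ (xm ℚ.* (ym ℚ.- yn)) (yn ℚ.* (xm ℚ.- xn)) ⟩
      ℚ.∣ xm ℚ.* (ym ℚ.- yn) ∣ ℚ.+ ℚ.∣ yn ℚ.* (xm ℚ.- xn) ∣
        ≤⟨ ℚ.+-mono-≤
             (∣*∣≤ xm (ym ℚ.- yn) (x-bound m (ℕ.m⊔n≤o⇒m≤o K L m≥KL))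
               (y-cauchy m n (ℕ.m⊔n≤o⇒n≤o M N m≥MN) (ℕ.m⊔n≤o⇒n≤o M N n≥MN)))
             (∣*∣≤ yn (xm ℚ.- xn) (y-bound n (ℕ.m⊔n≤o⇒n≤o K L n≥KL))
               (x-cauchy m n (ℕ.m⊔n≤o⇒m≤o M N m≥MN) (ℕ.m⊔n≤o⇒m≤o M N n≥MN))) ⟩
      A ℚ.* α ℚ.+ B ℚ.* β
        ≡⟨ cong₂ ℚ._+_ Aα≡½ε Bβ≡½ε ⟩
      ½ ℚ.* ε ℚ.+ ½ ℚ.* ε
        ≡⟨ ½*-sum ε ⟩
      ε ∎

infixl 7 _/suc_

_/suc_ : ℕ → ℕ → ℚ
k /suc n = + k ℚ./ suc n

square : ℚ → ℚ
square q = q ℚ.* q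

largest : ∀ {P : ℕ → Set} → (∀ k → Dec (P k)) → ℕ → ℕ
largest P? zero    = zero
largest P? (suc b) = if does (P? (suc b)) then suc b else largest P? b

SquareBelow : ℕ → ℚ → ℕ → Set
SquareBelow n q k = square (k /suc n) ℚ.≤ q

squareBelow? : ∀ n q k → Dec (SquareBelow n q k)
squareBelow? n q k = square (k /suc n) ℚ.≤? q

searchBound : ℕ → ℚ → ℕ
searchBound n q = suc ℤ.∣ ℚ.↥ q ∣ ℕ.* suc n

rootNumerator : ℕ → ℚ → ℕ
rootNumerator n q = largest (squareBelow? n q) (searchBound n q)

-- The largest multiple of 1/(n+1) whose square is at most q, for q ≥ 0
-- (see root-lower and root-upper). Opaque only to keep type checking fast.
opaque
  root : ℕ → ℚ → ℚ
  root n q = rootNumerator n q /suc n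

private
  /suc-nonNeg : ∀ k n → 0ℚ ℚ.≤ k /suc n
  /suc-nonNeg k n = ℚ.nonNegative⁻¹ (k /suc n) {{ℚ.normalize-nonNeg k (suc n)}}

  /suc-pos : ∀ n → 0ℚ ℚ.< 1 /suc n
  /suc-pos n = ℚ.positive⁻¹ (1 /suc n) {{ℚ.normalize-pos 1 (suc n)}}

  toℚᵘ-/suc : ∀ k n → ℚ.toℚᵘ (k /suc n) ℚᵘ.≃ mkℚᵘ (+ k) n
  toℚᵘ-/suc k n = ℚ.toℚᵘ-fromℚᵘ (mkℚᵘ (+ k) n)

  suc-/suc : ∀ k n → suc k /suc n ≡ k /suc n ℚ.+ 1 /suc n
  suc-/suc k n = ℚ.toℚᵘ-injective (begin
      ℚ.toℚᵘ (suc k /suc n)                              ≈⟨ toℚᵘ-/suc (suc k) n ⟩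
      mkℚᵘ (+ suc k) n                                   ≈⟨ *≡* (eq (+ k) (+ suc n)) ⟩
      mkℚᵘ (+ k) n ℚᵘ.+ mkℚᵘ (+ 1) n                     ≈⟨ ℚᵘ.+-cong (toℚᵘ-/suc k n) (toℚᵘ-/suc 1 n) ⟨
      ℚ.toℚᵘ (k /suc n) ℚᵘ.+ ℚ.toℚᵘ (1 /suc n)           ≈⟨ ℚ.toℚᵘ-homo-+ (k /suc n) (1 /suc n) ⟨
      ℚ.toℚᵘ (k /suc n ℚ.+ 1 /suc n)                     ∎)
    where
    open ℚᵘ.≃-Reasoning
    eq : ∀ k s → (+ 1 ℤ.+ k) ℤ.* (s ℤ.* s) ≡ (k ℤ.* s ℤ.+ + 1 ℤ.* s) ℤ.* s
    eq = solve 2 (λ k s → (con (+ 1) :+ k) :* (s :* s) := (k :* s :+ con (+ 1) :* s) :* s) refl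
      where
      open ℤ-Solver.+-*-Solver

  *-/suc : ∀ k n → (k ℕ.* suc n) /suc n ≡ k /suc 0
  *-/suc k n = ℚ.fromℚᵘ-cong {mkℚᵘ (+ (k ℕ.* suc n)) n} {mkℚᵘ (+ k) 0}
    (*≡* (trans (ℤ.*-identityʳ (+ (k ℕ.* suc n))) (ℤ.pos-* k (suc n))))

  ≤-∣↥∣ : ∀ q → q ℚ.≤ ℤ.∣ ℚ.↥ q ∣ /suc 0
  ≤-∣↥∣ q@(mkℚ i d _) = ℚ.toℚᵘ-cancel-≤ (begin
      mkℚᵘ i d                       ≤⟨ *≤* (ineq i) ⟩
      mkℚᵘ (+ ℤ.∣ i ∣) 0             ≃⟨ toℚᵘ-/suc ℤ.∣ i ∣ 0 ⟨
      ℚ.toℚᵘ (ℤ.∣ i ∣ /suc 0)        ∎)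
    where
    open ℚᵘ.≤-Reasoning
    ineq : ∀ i → i ℤ.* + 1 ℤ.≤ + ℤ.∣ i ∣ ℤ.* + suc d
    ineq (+ k)      = subst₂ ℤ._≤_ (ℤ.pos-* k 1) (ℤ.pos-* k (suc d))
                        (ℤ.+≤+ (ℕ.*-monoʳ-≤ k (ℕ.s≤s ℕ.z≤n)))
    ineq ℤ.-[1+ k ] = ℤ.-≤+

  square-mono-≤ : ∀ {p q} → 0ℚ ℚ.≤ p → p ℚ.≤ q → square p ℚ.≤ square q
  square-mono-≤ {p} {q} 0≤p p≤q = ℚ.≤-trans
    (ℚ.*-monoˡ-≤-nonNeg p {{ℚ.nonNegative 0≤p}} p≤q)
    (ℚ.*-monoʳ-≤-nonNeg q {{ℚ.nonNegative (ℚ.≤-trans 0≤p p≤q)}} p≤q)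

  square-cancel-< : ∀ {p q} → 0ℚ ℚ.≤ q → square p ℚ.< square q → p ℚ.< q
  square-cancel-< 0≤q p²<q² =
    ℚ.≰⇒> λ q≤p → ℚ.<-irrefl refl (ℚ.<-≤-trans p²<q² (square-mono-≤ 0≤q q≤p))

  largest-lower : ∀ {P : ℕ → Set} (P? : ∀ k → Dec (P k)) b → P 0 → P (largest P? b)
  largest-lower P? zero    P0 = P0
  largest-lower P? (suc b) P0 with P? (suc b)
  ... | yes p = p
  ... | no  _ = largest-lower P? b P0

  largest-upper : ∀ {P : ℕ → Set} (P? : ∀ k → Dec (P k)) b →
                  ¬ P (suc b) → ¬ P (suc (largest P? b))
  largest-upper P? zero    ¬P = ¬P
  largest-upper P? (suc b) ¬P with P? (suc b)
  ... | yes _  = ¬P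
  ... | no ¬P′ = largest-upper P? b ¬P′

  searchBound-upper : ∀ n q → q ℚ.< square (suc (searchBound n q) /suc n)
  searchBound-upper n q = begin-strict
      q                                 ≤⟨ ≤-∣↥∣ q ⟩
      P                                 ≡⟨ ℚ.+-identityʳ P ⟨
      P ℚ.+ 0ℚ                          <⟨ ℚ.+-monoʳ-< P (ℚ.positive⁻¹ 1ℚ) ⟩
      P ℚ.+ 1ℚ                          ≡⟨ ℚ.*-identityˡ (P ℚ.+ 1ℚ) ⟨
      1ℚ ℚ.* (P ℚ.+ 1ℚ)                 ≤⟨ ℚ.*-monoʳ-≤-nonNeg (P ℚ.+ 1ℚ) {{P+1≥0}} 1≤P+1 ⟩
      square (P ℚ.+ 1ℚ)                 ≡⟨ cong square (suc-/suc p 0) ⟨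
      square (suc p /suc 0)             ≡⟨ cong square (*-/suc (suc p) n) ⟨
      square (B /suc n)                 ≤⟨ square-mono-≤ (/suc-nonNeg B n) B≤ ⟩
      square (suc B /suc n)             ∎
    where
    open ℚ.≤-Reasoning
    p = ℤ.∣ ℚ.↥ q ∣
    P = p /suc 0
    B = searchBound n q
    1≤P+1 : 1ℚ ℚ.≤ P ℚ.+ 1ℚ
    1≤P+1 = subst (ℚ._≤ P ℚ.+ 1ℚ) (ℚ.+-identityˡ 1ℚ) (ℚ.+-monoˡ-≤ 1ℚ (/suc-nonNeg p 0))
    P+1≥0 = ℚ.nonNegative (ℚ.≤-trans (ℚ.<⇒≤ (ℚ.positive⁻¹ 1ℚ)) 1≤P+1)
    B≤ : B /suc n ℚ.≤ suc B /suc n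
    B≤ = subst₂ ℚ._≤_ (ℚ.+-identityʳ (B /suc n)) (sym (suc-/suc B n))
           (ℚ.+-monoʳ-≤ (B /suc n) (ℚ.<⇒≤ (/suc-pos n)))

opaque
  unfolding root

  root-nonNeg : ∀ n q → 0ℚ ℚ.≤ root n q
  root-nonNeg n q = /suc-nonNeg (rootNumerator n q) n

  root-lower : ∀ n q → 0ℚ ℚ.≤ q → square (root n q) ℚ.≤ q
  root-lower n q 0≤q = largest-lower (squareBelow? n q) (searchBound n q)
    (subst (λ z → square z ℚ.≤ q) (sym (ℚ.0/n≡0 (suc n))) 0≤q)

  root-upper : ∀ n q → q ℚ.< square (root n q ℚ.+ 1 /suc n)
  root-upper n q = subst (λ z → q ℚ.< square z) (suc-/suc (rootNumerator n q) n)
    (ℚ.≰⇒> (largest-upper (squareBelow? n q) (searchBound n q)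
      (λ ≤q → ℚ.<-irrefl refl (ℚ.<-≤-trans (searchBound-upper n q) ≤q))))

private
  archimedean : ∀ ε → 0ℚ ℚ.< ε → ∃ λ N → ∀ n → N ℕ.≤ n → 1 /suc n ℚ.≤ ε
  archimedean (mkℚ (+ zero) d _)    ε>0 with ℚ.drop-*<* ε>0
  ... | ℤ.+<+ ()
  archimedean (mkℚ ℤ.-[1+ k ] d _)  ε>0 with ℚ.drop-*<* ε>0
  ... | ()
  archimedean (mkℚ ℤ.+[1+ k ] d _) ε>0 = d , λ n d≤n → ℚ.toℚᵘ-cancel-≤ (begin
      ℚ.toℚᵘ (1 /suc n)     ≃⟨ toℚᵘ-/suc 1 n ⟩
      mkℚᵘ (+ 1) n          ≤⟨ *≤* (ℤ.+≤+ (ℕ.*-mono-≤ {1} {suc k} (ℕ.s≤s ℕ.z≤n) (ℕ.s≤s d≤n))) ⟩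
      mkℚᵘ (+ suc k) d      ∎)
    where
    open ℚᵘ.≤-Reasoning

  root-step : ∀ m n p q δ → 0ℚ ℚ.≤ p → 0ℚ ℚ.< δ → 1 /suc n ℚ.≤ δ → p ℚ.≤ q ℚ.+ square δ →
              root m p ℚ.≤ root n q ℚ.+ (δ ℚ.+ δ)
  root-step m n p q δ 0≤p δ>0 1/n≤δ p≤q+δ² = ℚ.<⇒≤ (square-cancel-< 0≤r+2δ (begin-strict
      square (root m p)                              ≤⟨ root-lower m p 0≤p ⟩
      p                                              ≤⟨ p≤q+δ² ⟩
      q ℚ.+ square δ                                 <⟨ ℚ.+-monoˡ-< (square δ) (root-upper n q) ⟩
      square (r ℚ.+ 1 /suc n) ℚ.+ square δ           ≤⟨ ℚ.+-monoˡ-≤ (square δ) (square-mono-≤ 0≤r+1/n (ℚ.+-monoʳ-≤ r 1/n≤δ)) ⟩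
      square (r ℚ.+ δ) ℚ.+ square δ                  ≡⟨ ℚ.+-identityʳ _ ⟨
      square (r ℚ.+ δ) ℚ.+ square δ ℚ.+ 0ℚ           ≤⟨ ℚ.+-monoʳ-≤ (square (r ℚ.+ δ) ℚ.+ square δ) 0≤2cδ ⟩
      square (r ℚ.+ δ) ℚ.+ square δ ℚ.+ ((r ℚ.+ δ) ℚ.* δ ℚ.+ (r ℚ.+ δ) ℚ.* δ)
                                                     ≡⟨ solve 2 (λ r δ → (r :+ δ) :* (r :+ δ) :+ δ :* δ :+ ((r :+ δ) :* δ :+ (r :+ δ) :* δ)
                                                                  := (r :+ (δ :+ δ)) :* (r :+ (δ :+ δ))) refl r δ ⟩
      square (r ℚ.+ (δ ℚ.+ δ))                       ∎))
    where
    open ℚ.≤-Reasoning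
    open ℚ-Solver.+-*-Solver
    r = root n q
    0≤δ : 0ℚ ℚ.≤ δ
    0≤δ = ℚ.<⇒≤ δ>0
    0≤r : 0ℚ ℚ.≤ r
    0≤r = root-nonNeg n q
    0≤r+1/n : 0ℚ ℚ.≤ r ℚ.+ 1 /suc n
    0≤r+1/n = ℚ.+-mono-≤ 0≤r (ℚ.<⇒≤ (/suc-pos n))
    0≤r+δ : 0ℚ ℚ.≤ r ℚ.+ δ
    0≤r+δ = ℚ.+-mono-≤ 0≤r 0≤δ
    0≤r+2δ : 0ℚ ℚ.≤ r ℚ.+ (δ ℚ.+ δ)
    0≤r+2δ = ℚ.+-mono-≤ 0≤r (ℚ.+-mono-≤ 0≤δ 0≤δ)
    0≤cδ : 0ℚ ℚ.≤ (r ℚ.+ δ) ℚ.* δ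
    0≤cδ = subst (ℚ._≤ (r ℚ.+ δ) ℚ.* δ) (ℚ.*-zeroˡ δ)
             (ℚ.*-monoʳ-≤-nonNeg δ {{ℚ.nonNegative 0≤δ}} 0≤r+δ)
    0≤2cδ : 0ℚ ℚ.≤ (r ℚ.+ δ) ℚ.* δ ℚ.+ (r ℚ.+ δ) ℚ.* δ
    0≤2cδ = ℚ.+-mono-≤ 0≤cδ 0≤cδ

  ⊔0-step : ∀ p q ε → 0ℚ ℚ.≤ ε → p ℚ.≤ q ℚ.+ ε → p ℚ.⊔ 0ℚ ℚ.≤ q ℚ.⊔ 0ℚ ℚ.+ ε
  ⊔0-step p q ε 0≤ε p≤ = ℚ.⊔-lub
    (ℚ.≤-trans p≤ (ℚ.+-monoˡ-≤ ε (ℚ.p≤p⊔q q 0ℚ)))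
    (ℚ.+-mono-≤ (ℚ.p≤q⊔p q 0ℚ) 0≤ε)

-- √ x is the square root of max(x, 0).
√ : ℝ → ℝ
√ x = mkℝ (λ n → root n (seq x n ℚ.⊔ 0ℚ)) λ ε ε>0 →
  let δ            = ½ ℚ.* ε
      δ>0          = ½*-pos ε>0
      δ²>0         = subst (ℚ._< square δ) (ℚ.*-zeroʳ δ) (ℚ.*-monoʳ-<-pos δ {{ℚ.positive δ>0}} δ>0)
      M , small    = archimedean δ δ>0
      N , x-cauchy = cauchy x (square δ) δ²>0
      step : ∀ m n → M ℕ.⊔ N ℕ.≤ m → M ℕ.⊔ N ℕ.≤ n →
             root m (seq x m ℚ.⊔ 0ℚ) ℚ.≤ root n (seq x n ℚ.⊔ 0ℚ) ℚ.+ ε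
      step = λ m n m≥ n≥ →
        subst (λ z → root m (seq x m ℚ.⊔ 0ℚ) ℚ.≤ root n (seq x n ℚ.⊔ 0ℚ) ℚ.+ z) (½*-sum ε)
          (root-step m n (seq x m ℚ.⊔ 0ℚ) (seq x n ℚ.⊔ 0ℚ) δ (ℚ.p≤q⊔p (seq x m) 0ℚ) δ>0
            (small n (ℕ.m⊔n≤o⇒m≤o M N n≥))
            (⊔0-step (seq x m) (seq x n) (square δ) (ℚ.<⇒≤ δ²>0)
              (∣-∣≤⁻¹ (seq x m) (seq x n) (square δ)
                (x-cauchy m n (ℕ.m⊔n≤o⇒n≤o M N m≥) (ℕ.m⊔n≤o⇒n≤o M N n≥)))))
  in M ℕ.⊔ N , λ m n m≥ n≥ →
       ∣-∣≤ (root m (seq x m ℚ.⊔ 0ℚ)) (root n (seq x n ℚ.⊔ 0ℚ)) ε (step m n m≥ n≥) (step n m n≥ m≥)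

ℝ² : Set
ℝ² = ℝ × ℝ

_≃²_ : Rel ℝ² 0ℓ
(x , y) ≃² (x′ , y′) = x ≃ x′ × y ≃ y′

distance : ℝ² → ℝ² → ℝ
distance (x , y) (x′ , y′) = √ ((x - x′) * (x - x′) + (y - y′) * (y - y′))

-- (a , b) stands for the cell [a , a + 1] × [b , b + 1].
Cell : Set
Cell = ℤ × ℤ

_≟ᶜ_ : DecidableEquality Cell
_≟ᶜ_ = Product.≡-dec ℤ._≟_ ℤ._≟_

_∈ᶜ_ : ℝ² → Cell → Set
(x , y) ∈ᶜ (a , b) =
  (fromℤ a ≤ x × x ≤ fromℤ (ℤ.suc a)) × (fromℤ b ≤ y × y ≤ fromℤ (ℤ.suc b))

record Instance : Set where
  field
    size      : ℕ
    nonEmpty  : ℕ.NonZero size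
    point     : Fin size → ℝ²
    injective : ∀ {i j} → point i ≃² point j → i ≡ j
    cell      : Fin size → Cell
    contains  : ∀ i → point i ∈ᶜ cell i

  NonEmptyCell : Cell → Set
  NonEmptyCell c = ∃ λ i → cell i ≡ c

  nonEmptyCells : List Cell
  nonEmptyCells = deduplicate _≟ᶜ_ (map cell (allFin size))

record Graph (n : ℕ) : Set₁ where
  field
    vertices   : Subset n
    Adjacent   : Rel (Fin n) 0ℓ
    adjacent?  : Decidable Adjacent
    symmetric  : Symmetric Adjacent
    loopless   : Irreflexive _≡_ Adjacent
    endpoint   : ∀ {i j} → Adjacent i j → i ∈ vertices

  -- Each undirected edge is listed once, smaller endpoint first.
  edges : List (Fin n × Fin n)
  edges = filter (λ (i , j) → (i Fin.<? j) ×-dec adjacent? i j)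
                 (cartesianProduct (allFin n) (allFin n))

  Connected : Set
  Connected = ∀ {i j} → i ∈ vertices → j ∈ vertices → Star Adjacent i j

  -- The cycle u, x, …, v, u; the middle part is non-empty, so its length is at least 3.
  record Cycle : Set where
    field
      u x v    : Fin n
      xs       : List (Fin n)
    path : List (Fin n)
    path = u ∷ x ∷ xs ∷ʳ v
    field
      linked   : Linked Adjacent path
      distinct : Unique path
      closing  : Adjacent v u

  IsTree : Set
  IsTree = Connected × ¬ Cycle

module _ (I : Instance) where
  open Instance I

  weight : Graph size → ℝ
  weight G = foldr _+_ (fromℕ 0)
    (map (λ (i , j) → distance (point i) (point j)) (Graph.edges G))

  IsFeasible : Graph size → Set
  IsFeasible T = Graph.IsTree T ×
    (∀ c → NonEmptyCell c → ∃! _≡_ λ i → i ∈ Graph.vertices T × cell i ≡ c)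

  IsOptimal : Graph size → Set₁
  IsOptimal T = IsFeasible T × (∀ T′ → IsFeasible T′ → weight T ≤ weight T′)

{-# OPTIONS --safe #-}

-- Only feasibility matters. The square of side 2 centred at a point contains the cell of that
-- point, so the union of these squares over the vertices of T has area at least N + 1. Adding
-- the vertices along the edges of T, an edge of length ρ increases the area by at most
-- 2(∣Δx∣ + ∣Δy∣) ≤ 4ρ, and the first square has area 4; hence N + 1 ≤ 4 + 4 w(T).
-- Area is replaced by an average over M lattices shifted along the diagonal: such a lattice
-- meets each square in a 2 × 2 block. Coordinates are rounded to multiples of 1/M, and M → ∞.
module Submission where

open import Defs
open import Data.Nat.Base as ℕ using (ℕ; zero; suc; z≤n; s≤s)
import Data.Nat.Properties as ℕ
import Data.Nat.Solver as ℕ-Solver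
open import Data.Nat.ListAction using (sum)
open import Data.Nat.ListAction.Properties using (sum-↭)
open import Data.Integer.Base as ℤ using (ℤ; +_; -[1+_]; ∣_∣)
import Data.Integer.Properties as ℤ
import Data.Integer.Solver as ℤ-Solver
open import Data.Rational.Base as ℚ using (ℚ; mkℚ; 0ℚ; 1ℚ)
import Data.Rational.Properties as ℚ
import Data.Rational.Solver as ℚ-Solver
open import Data.Rational.Unnormalised.Base as ℚᵘ using (mkℚᵘ; *≡*; *≤*)
import Data.Rational.Unnormalised.Properties as ℚᵘ
open import Data.Fin.Base as Fin using (Fin; zero; suc)
import Data.Fin.Properties as Fin
import Data.Fin.Subset as Subset
open import Data.List.Base
  using (List; []; _∷_; _++_; [_]; map; foldr; length; applyUpTo; allFin; cartesianProduct)
open import Data.List.Properties using (length-++; length-map; map-cong)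
open import Data.List.Membership.Propositional using (_∈_; _∉_; find; lose)
open import Data.List.Membership.Propositional.Properties
  using (∈-∃++; ∈-++⁺ˡ; ∈-++⁺ʳ; ∈-++⁻; ∈-cartesianProduct⁺; ∈-cartesianProduct⁻;
         ∈-filter⁺; ∈-allFin; ∈-map⁻; ∈-deduplicate⁻)
import Data.List.Membership.DecPropositional as DecMembership
import Data.List.Relation.Unary.All as All
open import Data.List.Relation.Unary.Any using (here; there; any?)
open import Data.List.Relation.Unary.Unique.Propositional using (Unique; []; _∷_)
open import Data.List.Relation.Unary.Unique.DecPropositional.Properties _≟ᶜ_ using (deduplicate-!)
open import Data.List.Relation.Binary.Permutation.Propositional using (_↭_)
open import Data.List.Relation.Binary.Permutation.Propositional.Properties
  using (shift; ∈-resp-↭; ↭-length; map⁺)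
open import Data.Product.Base using (∃; _×_; _,_; proj₁; proj₂)
open import Data.Sum.Base using (_⊎_; inj₁; inj₂)
open import Data.Empty using (⊥-elim)
open import Function.Base using (_∘_)
open import Relation.Nullary using (Dec; ¬_; yes; no; ¬?; _×-dec_; _⊎-dec_)
open import Relation.Binary.Definitions using (DecidableEquality; tri<; tri≈; tri>)
open import Relation.Binary.Construct.Closure.ReflexiveTransitive
  using (Star; _◅_) renaming (ε to nil)
open import Relation.Binary.PropositionalEquality
  using (_≡_; refl; sym; trans; cong; cong₂; subst; subst₂; module ≡-Reasoning)

-- Growing a connected vertex set

module _ {A : Set} where

  ∈⇒↭ : ∀ {x : A} {xs} → x ∈ xs → ∃ λ ys → xs ↭ x ∷ ys
  ∈⇒↭ {x} x∈xs with ∈-∃++ x∈xs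
  ... | ys , zs , refl = ys ++ zs , shift x ys zs

  unique-⊆⇒length-≤ : ∀ {xs ys : List A} → Unique xs → (∀ {x} → x ∈ xs → x ∈ ys) →
                      length xs ℕ.≤ length ys
  unique-⊆⇒length-≤ [] _ = z≤n
  unique-⊆⇒length-≤ {x ∷ xs} (x∉xs ∷ xs!) xs⊆ys with ∈⇒↭ (xs⊆ys (here refl))
  ... | zs , ys↭ = subst (suc (length xs) ℕ.≤_) (sym (↭-length ys↭))
    (s≤s (unique-⊆⇒length-≤ xs! λ y∈xs → drop y∈xs (∈-resp-↭ ys↭ (xs⊆ys (there y∈xs)))))
    where
    drop : ∀ {y} → y ∈ xs → y ∈ x ∷ zs → y ∈ zs
    drop y∈xs (here refl)  = ⊥-elim (All.lookup x∉xs y∈xs refl)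
    drop _    (there y∈zs) = y∈zs

module _ {V : Set} where

  -- `edges` lists each undirected edge once, as an ordered pair, so a walk must be able to use a
  -- pair in either direction. The walk may begin anywhere in `R`, which lets `R` grow while edges
  -- are consumed.
  data Reached (E : List (V × V)) (R : List V) : V → Set where
    start : ∀ {v} → v ∈ R → Reached E R v
    forth : ∀ {u v} → (u , v) ∈ E → Reached E R u → Reached E R v
    back  : ∀ {u v} → (v , u) ∈ E → Reached E R u → Reached E R v

  module _ {E E′ R w} (e : V × V) (E↭ : E ↭ e ∷ E′)
           (R₁ : proj₁ e ∈ w ∷ R) (R₂ : proj₂ e ∈ w ∷ R) where

    Reached-contract : ∀ {v} → Reached E R v → Reached E′ (w ∷ R) v
    Reached-contract (start v∈R) = start (there v∈R)
    Reached-contract (forth e∈E r) with ∈-resp-↭ E↭ e∈E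
    ... | here refl    = start R₂
    ... | there e∈E′   = forth e∈E′ (Reached-contract r)
    Reached-contract (back e∈E r) with ∈-resp-↭ E↭ e∈E
    ... | here refl    = start R₁
    ... | there e∈E′   = back e∈E′ (Reached-contract r)

-- `extend` is the only geometric input: passing from `u` to `v` requires at most `cost (u , v)`
-- elements outside `block u`. This is the discrete form of the bound on the area added along one
-- edge.
module Growth
  {V C : Set} (_≟_ : DecidableEquality V) (block : V → List C) (cost : V × V → ℕ)
  (cost-sym : ∀ u v → cost (u , v) ≡ cost (v , u))
  (extend : ∀ u v → ∃ λ D → length D ℕ.≤ cost (u , v) ×
                            (∀ {c} → c ∈ block v → c ∈ D ++ block u))
  where

  open DecMembership _≟_ using (_∈?_)

  Crossing : List V → V × V → Set
  Crossing R (u , v) = (u ∈ R × v ∉ R) ⊎ (v ∈ R × u ∉ R)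

  crossing? : ∀ R e → Dec (Crossing R e)
  crossing? R (u , v) =
    ((u ∈? R) ×-dec ¬? (v ∈? R)) ⊎-dec ((v ∈? R) ×-dec ¬? (u ∈? R))

  closed : ∀ {E R} → (∀ {e} → e ∈ E → ¬ Crossing R e) → ∀ {v} → Reached E R v → v ∈ R
  closed none (start v∈R) = v∈R
  closed {R = R} none {v} (forth e∈E r) with v ∈? R
  ... | yes v∈R = v∈R
  ... | no v∉R  = ⊥-elim (none e∈E (inj₁ (closed none r , v∉R)))
  closed {R = R} none {v} (back e∈E r) with v ∈? R
  ... | yes v∈R = v∈R
  ... | no v∉R  = ⊥-elim (none e∈E (inj₂ (closed none r , v∉R)))

  Covers : List C → List V → Set
  Covers L R = ∀ {v} → v ∈ R → ∀ {c} → c ∈ block v → c ∈ L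

  covers-extend : ∀ {L R u v D} → Covers L R → u ∈ R →
                  (∀ {c} → c ∈ block v → c ∈ D ++ block u) → Covers (D ++ L) (v ∷ R)
  covers-extend {D = D} cov u∈R ext (there w∈R) c∈ = ∈-++⁺ʳ D (cov w∈R c∈)
  covers-extend {D = D} cov u∈R ext (here refl) c∈ with ∈-++⁻ D (ext c∈)
  ... | inj₁ c∈D = ∈-++⁺ˡ c∈D
  ... | inj₂ c∈u = ∈-++⁺ʳ D (cov u∈R c∈u)

  CoveredFrom : List (V × V) → List V → List C → Set
  CoveredFrom E R L =
    ∃ λ L′ → length L′ ℕ.≤ length L ℕ.+ sum (map cost E) ×
             (∀ {v} → Reached E R v → ∀ {c} → c ∈ block v → c ∈ L′)

  cover : ∀ {k E R L} → length E ≡ k → Covers L R → CoveredFrom E R L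
  cover {k} {E} {R} {L} ∣E∣≡k cov with any? (crossing? R) E
  ... | no none = L , ℕ.m≤m+n (length L) _ , λ r → cov (closed (λ e∈E → none ∘ lose e∈E) r)
  ... | yes some with find some
  ... | (u , v) , e∈E , cr with ∈⇒↭ e∈E
  ... | E′ , E↭ = go k ∣E∣≡k cr
    where
    e = u , v
    sumE : sum (map cost E) ≡ cost e ℕ.+ sum (map cost E′)
    sumE = sum-↭ (map⁺ cost E↭)

    add : ∀ {k} D w → length E′ ≡ k → length D ℕ.≤ cost e → Covers (D ++ L) (w ∷ R) →
          u ∈ w ∷ R → v ∈ w ∷ R → CoveredFrom E R L
    add D w ∣E′∣≡k ∣D∣≤ cov′ u∈ v∈ with cover ∣E′∣≡k cov′
    ... | L′ , ∣L′∣≤ , cov″ = L′ , bound , cov″ ∘ Reached-contract e E↭ u∈ v∈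
      where
      open ℕ.≤-Reasoning
      S = sum (map cost E′)
      bound = begin
        length L′                        ≤⟨ ∣L′∣≤ ⟩
        length (D ++ L) ℕ.+ S            ≡⟨ cong (ℕ._+ S) (length-++ D) ⟩
        length D ℕ.+ length L ℕ.+ S      ≤⟨ ℕ.+-monoˡ-≤ S (ℕ.+-monoˡ-≤ (length L) ∣D∣≤) ⟩
        cost e ℕ.+ length L ℕ.+ S        ≡⟨ cong (ℕ._+ S) (ℕ.+-comm (cost e) (length L)) ⟩
        length L ℕ.+ cost e ℕ.+ S        ≡⟨ ℕ.+-assoc (length L) (cost e) S ⟩
        length L ℕ.+ (cost e ℕ.+ S)      ≡⟨ cong (length L ℕ.+_) sumE ⟨
        length L ℕ.+ sum (map cost E)    ∎

    go : ∀ k → length E ≡ k → Crossing R e → CoveredFrom E R L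
    go zero    ∣E∣≡ _ with () ← trans (sym ∣E∣≡) (↭-length E↭)
    go (suc k) ∣E∣≡ cr with ℕ.suc-injective (trans (sym (↭-length E↭)) ∣E∣≡)
    go (suc k) ∣E∣≡ (inj₁ (u∈R , _)) | ∣E′∣≡ with extend u v
    ... | D , ∣D∣≤ , ext = add D v ∣E′∣≡ ∣D∣≤ (covers-extend cov u∈R ext) (there u∈R) (here refl)
    go (suc k) ∣E∣≡ (inj₂ (v∈R , _)) | ∣E′∣≡ with extend v u
    ... | D , ∣D∣≤ , ext = add D u ∣E′∣≡ (subst (length D ℕ.≤_) (cost-sym v u) ∣D∣≤)
                             (covers-extend cov v∈R ext) (here refl) (there v∈R)

-- Lattice blocks

length-cartesianProduct : ∀ {A B : Set} (xs : List A) (ys : List B) →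
                          length (cartesianProduct xs ys) ≡ length xs ℕ.* length ys
length-cartesianProduct []       ys = refl
length-cartesianProduct (x ∷ xs) ys = trans (length-++ (map (x ,_) ys))
  (cong₂ ℕ._+_ (length-map (x ,_) ys) (length-cartesianProduct xs ys))

-- In units of 1/M, cell `a` is sampled at shift `t` by the point aM + 1 + t. If `k` is the level at
-- shift `t` of a point at position X, then `pair k` holds the two `a` whose samples lie in (X - M,
-- X + M].
pair : ℤ → List ℤ
pair k = k ∷ ℤ.pred k ∷ []

-- Neighbouring pairs share one element and equal pairs share both, so the number of new elements
-- never exceeds the distance moved.
pair-extend : ∀ k k′ → ∃ λ D → length D ℕ.≤ ∣ k′ ℤ.- k ∣ ×
                               (∀ {a} → a ∈ pair k′ → a ∈ D ++ pair k)
pair-extend k k′ = subst Goal k+d≡k′ (go (k′ ℤ.- k))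
  where
  Goal : ℤ → Set
  Goal z = ∃ λ D → length D ℕ.≤ ∣ k′ ℤ.- k ∣ × (∀ {a} → a ∈ pair z → a ∈ D ++ pair k)
  k+d≡k′ : (k′ ℤ.- k) ℤ.+ k ≡ k′
  k+d≡k′ = solve 2 (λ k k′ → (k′ :- k) :+ k := k′) refl k k′
    where open ℤ-Solver.+-*-Solver
  go : ∀ d → ∃ λ D → length D ℕ.≤ ∣ d ∣ × (∀ {a} → a ∈ pair (d ℤ.+ k) → a ∈ D ++ pair k)
  go (+ 0) = [] , z≤n , λ {a} → subst (λ z → a ∈ pair z) (ℤ.+-identityˡ k)
  go (+ 1) = [ ℤ.suc k ] , s≤s z≤n , λ
    { (here eq)         → here eq
    ; (there (here eq)) → there (here (trans eq (ℤ.pred-suc k))) }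
  go (-[1+ 0 ]) = [ ℤ.pred (ℤ.pred k) ] , s≤s z≤n , λ
    { (here eq)         → there (there (here eq))
    ; (there (here eq)) → here eq }
  -- From distance two on, the whole new pair is added; its length 2 is at most the distance.
  go d@(+ suc (suc _))  = pair (d ℤ.+ k) , s≤s (s≤s z≤n) , ∈-++⁺ˡ
  go d@(-[1+ suc _ ])   = pair (d ℤ.+ k) , s≤s (s≤s z≤n) , ∈-++⁺ˡ

block : ℤ × ℤ → List (ℤ × ℤ)
block (k , l) = cartesianProduct (pair k) (pair l)

-- Twice the taxicab distance: each unit step of a 2 × 2 block in one coordinate uncovers at most
-- one line of two lattice points.
gridCost : ℤ × ℤ → ℤ × ℤ → ℕ
gridCost (k , l) (k′ , l′) = 2 ℕ.* (∣ k ℤ.- k′ ∣ ℕ.+ ∣ l ℤ.- l′ ∣)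

gridCost-sym : ∀ p q → gridCost p q ≡ gridCost q p
gridCost-sym (k , l) (k′ , l′) =
  cong₂ (λ m n → 2 ℕ.* (m ℕ.+ n)) (ℤ.∣i-j∣≡∣j-i∣ k k′) (ℤ.∣i-j∣≡∣j-i∣ l l′)

block-extend : ∀ p q → ∃ λ D → length D ℕ.≤ gridCost q p ×
                               (∀ {c} → c ∈ block q → c ∈ D ++ block p)
block-extend (k , l) (k′ , l′) with pair-extend k k′ | pair-extend l l′
... | D , ∣D∣≤ , D-ext | E , ∣E∣≤ , E-ext = F , ∣F∣≤ , F-ext
  where
  -- A point of the new block outside the old one has either a new first coordinate, counted in
  -- `F₁`, or an old first and a new second coordinate, counted in `F₂`.
  F₁ = cartesianProduct D (pair l′)
  F₂ = cartesianProduct (pair k) E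
  F  = F₁ ++ F₂
  ∣F∣≤ : length F ℕ.≤ gridCost (k′ , l′) (k , l)
  ∣F∣≤ = begin
      length F                             ≡⟨ length-++ F₁ ⟩
      length F₁ ℕ.+ length F₂              ≡⟨ cong₂ ℕ._+_ (length-cartesianProduct D (pair l′)) (length-cartesianProduct (pair k) E) ⟩
      length D ℕ.* 2 ℕ.+ 2 ℕ.* length E    ≡⟨ cong (ℕ._+ 2 ℕ.* length E) (ℕ.*-comm (length D) 2) ⟩
      2 ℕ.* length D ℕ.+ 2 ℕ.* length E    ≡⟨ ℕ.*-distribˡ-+ 2 (length D) (length E) ⟨
      2 ℕ.* (length D ℕ.+ length E)        ≤⟨ ℕ.*-monoʳ-≤ 2 (ℕ.+-mono-≤ ∣D∣≤ ∣E∣≤) ⟩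
      gridCost (k′ , l′) (k , l)           ∎
    where open ℕ.≤-Reasoning
  F-ext : ∀ {c} → c ∈ block (k′ , l′) → c ∈ F ++ block (k , l)
  F-ext {a , b} c∈ with ∈-cartesianProduct⁻ (pair k′) (pair l′) c∈
  ... | a∈ , b∈ with ∈-++⁻ D (D-ext a∈) | ∈-++⁻ E (E-ext b∈)
  ... | inj₁ a∈D | _         = ∈-++⁺ˡ (∈-++⁺ˡ (∈-cartesianProduct⁺ a∈D b∈))
  ... | inj₂ a∈k | inj₁ b∈E  = ∈-++⁺ˡ (∈-++⁺ʳ F₁ (∈-cartesianProduct⁺ a∈k b∈E))
  ... | inj₂ a∈k | inj₂ b∈l  = ∈-++⁺ʳ F (∈-cartesianProduct⁺ a∈k b∈l)

module _ {V : Set} (_≟_ : DecidableEquality V) where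

  -- The count for a single lattice: growth starts from the block of the root, whose 4 elements give
  -- the constant, and the resulting list contains each of the distinct cells.
  covered-cells : ∀ (p : V → ℤ × ℤ) (E : List (V × V)) (r : V) {cs} → Unique cs →
    (∀ {c} → c ∈ cs → ∃ λ v → Reached E [ r ] v × c ∈ block (p v)) →
    length cs ℕ.≤ 4 ℕ.+ sum (map (λ (u , v) → gridCost (p u) (p v)) E)
  covered-cells p E r {cs} cs! covered =
    let L , ∣L∣≤ , cov = cover {E = E} {R = [ r ]} {L = block (p r)} refl root-covered
    in ℕ.≤-trans (unique-⊆⇒length-≤ cs! λ c∈ → let _ , r , c∈v = covered c∈ in cov r c∈v) ∣L∣≤
    where
    cost : V × V → ℕ
    cost (u , v) = gridCost (p u) (p v)
    extend : ∀ u v → ∃ λ D → length D ℕ.≤ cost (u , v) ×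
                             (∀ {c} → c ∈ block (p v) → c ∈ D ++ block (p u))
    extend u v =
      let D , ∣D∣≤ , ext = block-extend (p u) (p v)
      in D , subst (length D ℕ.≤_) (gridCost-sym (p v) (p u)) ∣D∣≤ , ext
    open Growth _≟_ (λ v → block (p v)) cost (λ u v → gridCost-sym (p u) (p v)) extend
    root-covered : Covers (block (p r)) [ r ]
    root-covered (here refl) c∈ = c∈

-- Averaging over the shifted lattices

∑< : ℕ → (ℕ → ℕ) → ℕ
∑< M f = sum (applyUpTo f M)

∑<-mono : ∀ M {f g} → (∀ t → f t ℕ.≤ g t) → ∑< M f ℕ.≤ ∑< M g
∑<-mono zero    f≤g = z≤n
∑<-mono (suc M) f≤g = ℕ.+-mono-≤ (f≤g 0) (∑<-mono M (f≤g ∘ suc))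

∑<-cong : ∀ M {f g} → (∀ t → f t ≡ g t) → ∑< M f ≡ ∑< M g
∑<-cong zero    f≡g = refl
∑<-cong (suc M) f≡g = cong₂ ℕ._+_ (f≡g 0) (∑<-cong M (f≡g ∘ suc))

∑<-const : ∀ M c → ∑< M (λ _ → c) ≡ M ℕ.* c
∑<-const zero    c = refl
∑<-const (suc M) c = cong (c ℕ.+_) (∑<-const M c)

∑<-+ : ∀ M f g → ∑< M (λ t → f t ℕ.+ g t) ≡ ∑< M f ℕ.+ ∑< M g
∑<-+ zero    f g = refl
∑<-+ (suc M) f g = trans (cong (f 0 ℕ.+ g 0 ℕ.+_) (∑<-+ M (f ∘ suc) (g ∘ suc)))
  (solve 4 (λ a b c d → a :+ b :+ (c :+ d) := a :+ c :+ (b :+ d)) refl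
    (f 0) (g 0) (∑< M (f ∘ suc)) (∑< M (g ∘ suc)))
  where open ℕ-Solver.+-*-Solver

∑<-* : ∀ M c f → ∑< M (λ t → c ℕ.* f t) ≡ c ℕ.* ∑< M f
∑<-* zero    c f = sym (ℕ.*-zeroʳ c)
∑<-* (suc M) c f = trans (cong (c ℕ.* f 0 ℕ.+_) (∑<-* M c (f ∘ suc)))
  (sym (ℕ.*-distribˡ-+ c (f 0) (∑< M (f ∘ suc))))

∑<-swap : ∀ {A : Set} M (f : ℕ → A → ℕ) xs →
          ∑< M (λ t → sum (map (f t) xs)) ≡ sum (map (λ x → ∑< M (λ t → f t x)) xs)
∑<-swap M f []       = trans (∑<-const M 0) (ℕ.*-zeroʳ M)
∑<-swap M f (x ∷ xs) = trans (∑<-+ M (λ t → f t x) (λ t → sum (map (f t) xs)))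
  (cong (∑< M (λ t → f t x) ℕ.+_) (∑<-swap M f xs))

∑<-∸ : ∀ M {f g} → (∀ t → g t ℕ.≤ f t) → ∑< M (λ t → f t ℕ.∸ g t) ≡ ∑< M f ℕ.∸ ∑< M g
∑<-∸ M {f} {g} g≤f = begin
  ∑< M (λ t → f t ℕ.∸ g t)                        ≡⟨ ℕ.m+n∸n≡m _ (∑< M g) ⟨
  ∑< M (λ t → f t ℕ.∸ g t) ℕ.+ ∑< M g ℕ.∸ ∑< M g  ≡⟨ cong (ℕ._∸ ∑< M g) (∑<-+ M (λ t → f t ℕ.∸ g t) g) ⟨
  ∑< M (λ t → f t ℕ.∸ g t ℕ.+ g t) ℕ.∸ ∑< M g     ≡⟨ cong (ℕ._∸ ∑< M g) (∑<-cong M (λ t → ℕ.m∸n+n≡m (g≤f t))) ⟩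
  ∑< M f ℕ.∸ ∑< M g                               ∎
  where open ≡-Reasoning

-- The indicator of `t < r`.
below : ℕ → ℕ → ℕ
below r       zero    = 0
below zero    (suc r) = 1
below (suc t) (suc r) = below t r

below-≤1 : ∀ t r → below t r ℕ.≤ 1
below-≤1 t       zero    = z≤n
below-≤1 zero    (suc r) = s≤s z≤n
below-≤1 (suc t) (suc r) = below-≤1 t r

below-mono : ∀ t {r s} → r ℕ.≤ s → below t r ℕ.≤ below t s
below-mono t       {zero}          _         = z≤n
below-mono zero    {suc r} {suc s} _         = ℕ.≤-refl
below-mono (suc t) {suc r} {suc s} (s≤s r≤s) = below-mono t r≤s

∑<-below : ∀ M {r} → r ℕ.≤ M → ∑< M (λ t → below t r) ≡ r
∑<-below M {zero} z≤n = trans (∑<-cong M (λ { zero → refl ; (suc _) → refl })) (trans (∑<-const M 0) (ℕ.*-zeroʳ M))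
∑<-below (suc M) {suc r} (s≤s r≤M) = cong suc (∑<-below M r≤M)

≤⇒+ : ∀ {i j} → i ℤ.≤ j → ∃ λ d → i ℤ.+ + d ≡ j
≤⇒+ {i} {j} i≤j = ∣ i ℤ.- j ∣ , trans (cong (λ z → i ℤ.+ z) (ℤ.∣-∣-≤ i≤j))
  (solve 2 (λ i j → i :+ (j :- i) := j) refl i j)
  where open ℤ-Solver.+-*-Solver

gap-∸ : ∀ a {i j} → j ℕ.≤ i → ∣ (a ℤ.+ + i) ℤ.- (a ℤ.+ + j) ∣ ≡ i ℕ.∸ j
gap-∸ a {i} {j} j≤i = cong ∣_∣ (begin
  (a ℤ.+ + i) ℤ.- (a ℤ.+ + j)  ≡⟨ solve 3 (λ a i j → (a :+ i) :- (a :+ j) := i :- j) refl a (+ i) (+ j) ⟩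
  + i ℤ.- + j                  ≡⟨ ℤ.m-n≡m⊖n i j ⟩
  i ℤ.⊖ j                      ≡⟨ ℤ.⊖-≥ j≤i ⟩
  + (i ℕ.∸ j)                  ∎)
  where
  open ≡-Reasoning
  open ℤ-Solver.+-*-Solver

module _ (M : ℕ) where

  -- For r ≤ M, level (a , r) t = a + [t < r] is the floor of (aM + r + (M - 1 - t)) / M.
  level : ℤ × ℕ → ℕ → ℤ
  level (a , r) t = a ℤ.+ + below t r

  -- The coordinate in units of 1/M. The remainder may be as large as M, so a point on the upper
  -- border of its closed cell keeps the index `a` of that cell.
  position : ℤ × ℕ → ℤ
  position (a , r) = a ℤ.* + M ℤ.+ + r

  Averages : ℤ × ℕ → ℤ × ℕ → Set
  Averages p q = ∑< M (λ t → ∣ level p t ℤ.- level q t ∣) ≡ ∣ position p ℤ.- position q ∣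

  averages-sym : ∀ p q → Averages p q → Averages q p
  averages-sym p q avg = begin
    ∑< M (λ t → ∣ level q t ℤ.- level p t ∣)  ≡⟨ ∑<-cong M (λ t → ℤ.∣i-j∣≡∣j-i∣ (level q t) (level p t)) ⟩
    ∑< M (λ t → ∣ level p t ℤ.- level q t ∣)  ≡⟨ avg ⟩
    ∣ position p ℤ.- position q ∣             ≡⟨ ℤ.∣i-j∣≡∣j-i∣ (position p) (position q) ⟩
    ∣ position q ℤ.- position p ∣             ∎
    where open ≡-Reasoning

  -- When one level dominates the other at every shift, the absolute values disappear and the two
  -- sums can be taken separately. Exactly r of the M shifts satisfy t < r, so the levels of (a , r)
  -- add up to aM + r, which is Hermite's identity for floors.
  averages-ordered : ∀ a d {r s} → r ℕ.≤ M → s ℕ.≤ M → (∀ t → below t r ℕ.≤ d ℕ.+ below t s) →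
                     Averages (a ℤ.+ + d , s) (a , r)
  averages-ordered a d {r} {s} r≤M s≤M r≤d+s = begin
    ∑< M (λ t → ∣ (a ℤ.+ + d ℤ.+ + below t s) ℤ.- (a ℤ.+ + below t r) ∣)
      ≡⟨ ∑<-cong M (λ t → trans (cong (λ z → ∣ z ℤ.- (a ℤ.+ + below t r) ∣) (ℤ.+-assoc a (+ d) (+ below t s)))
                                (gap-∸ a (r≤d+s t))) ⟩
    ∑< M (λ t → d ℕ.+ below t s ℕ.∸ below t r)
      ≡⟨ ∑<-∸ M r≤d+s ⟩
    ∑< M (λ t → d ℕ.+ below t s) ℕ.∸ ∑< M (λ t → below t r)
      ≡⟨ cong₂ ℕ._∸_ ∑d+s (∑<-below M r≤M) ⟩
    d ℕ.* M ℕ.+ s ℕ.∸ r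
      ≡⟨ gap-∸ (a ℤ.* + M) r≤dM+s ⟨
    ∣ (a ℤ.* + M ℤ.+ + (d ℕ.* M ℕ.+ s)) ℤ.- (a ℤ.* + M ℤ.+ + r) ∣
      ≡⟨ cong (λ z → ∣ z ℤ.- (a ℤ.* + M ℤ.+ + r) ∣) regroup ⟩
    ∣ ((a ℤ.+ + d) ℤ.* + M ℤ.+ + s) ℤ.- (a ℤ.* + M ℤ.+ + r) ∣ ∎
    where
    open ≡-Reasoning
    ∑d+s : ∑< M (λ t → d ℕ.+ below t s) ≡ d ℕ.* M ℕ.+ s
    ∑d+s = trans (∑<-+ M (λ _ → d) (λ t → below t s))
      (cong₂ ℕ._+_ (trans (∑<-const M d) (ℕ.*-comm M d)) (∑<-below M s≤M))
    r≤dM+s : r ℕ.≤ d ℕ.* M ℕ.+ s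
    r≤dM+s = subst₂ ℕ._≤_ (∑<-below M r≤M) ∑d+s (∑<-mono M r≤d+s)
    regroup : a ℤ.* + M ℤ.+ + (d ℕ.* M ℕ.+ s) ≡ (a ℤ.+ + d) ℤ.* + M ℤ.+ + s
    regroup = trans (cong (λ z → a ℤ.* + M ℤ.+ (z ℤ.+ + s)) (ℤ.pos-* d M))
      (solve 4 (λ a d m s → a :* m :+ (d :* m :+ s) := (a :+ d) :* m :+ s) refl a (+ d) (+ M) (+ s))
      where open ℤ-Solver.+-*-Solver

  -- Domination at every shift always holds in one direction: within one cell the larger remainder
  -- wins, and across cells the offset `d` ≥ 1 outweighs any indicator.
  averages-≤ : ∀ a d {r s} → r ℕ.≤ M → s ℕ.≤ M → Averages (a ℤ.+ + d , s) (a , r)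
  averages-≤ a zero {r} {s} r≤M s≤M with ℕ.≤-total r s
  ... | inj₁ r≤s = averages-ordered a 0 r≤M s≤M (λ t → below-mono t r≤s)
  ... | inj₂ s≤r = subst (λ b → Averages (b , s) (a , r)) (sym (ℤ.+-identityʳ a))
      (averages-sym (a , r) (a , s) (subst (λ b → Averages (b , r) (a , s)) (ℤ.+-identityʳ a)
        (averages-ordered a 0 s≤M r≤M (λ t → below-mono t s≤r))))
  averages-≤ a (suc d) {r} r≤M s≤M = averages-ordered a (suc d) r≤M s≤M
    (λ t → ℕ.≤-trans (below-≤1 t r) (s≤s z≤n))

  averages : ∀ p q → proj₂ p ℕ.≤ M → proj₂ q ℕ.≤ M → Averages p q
  averages (a , r) (b , s) r≤M s≤M with ℤ.≤-total a b
  ... | inj₁ a≤b with ≤⇒+ a≤b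
  ... | d , refl = averages-sym (a ℤ.+ + d , s) (a , r) (averages-≤ a d r≤M s≤M)
  averages (a , r) (b , s) r≤M s≤M | inj₂ b≤a with ≤⇒+ b≤a
  ... | d , refl = averages-≤ b d s≤M r≤M

  -- The bound of `covered-cells` is summed over all M shifts and the two sums are exchanged. For
  -- each edge the costs then add up exactly to the grid cost between positions, so averaging itself
  -- loses nothing.
  average-cells : ∀ {V : Set} → DecidableEquality V → ∀ (p q : V → ℤ × ℕ) →
    (∀ v → proj₂ (p v) ℕ.≤ M) → (∀ v → proj₂ (q v) ℕ.≤ M) →
    ∀ (E : List (V × V)) r {cs} → Unique cs →
    (∀ {c} → c ∈ cs → ∃ λ v → Reached E [ r ] v × (proj₁ (p v) , proj₁ (q v)) ≡ c) →
    M ℕ.* length cs ℕ.≤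
      M ℕ.* 4 ℕ.+ sum (map (λ (u , v) → gridCost (position (p u) , position (q u))
                                                 (position (p v) , position (q v))) E)
  average-cells {V} _≟_ p q p≤M q≤M E r {cs} cs! covered = begin
    M ℕ.* length cs                             ≡⟨ ∑<-const M (length cs) ⟨
    ∑< M (λ _ → length cs)                      ≤⟨ ∑<-mono M each ⟩
    ∑< M (λ t → 4 ℕ.+ sum (map (cost t) E))     ≡⟨ ∑<-+ M (λ _ → 4) (λ t → sum (map (cost t) E)) ⟩
    ∑< M (λ _ → 4) ℕ.+ ∑< M (λ t → sum (map (cost t) E))
                                                ≡⟨ cong₂ ℕ._+_ (∑<-const M 4) (∑<-swap M cost E) ⟩
    M ℕ.* 4 ℕ.+ sum (map (λ e → ∑< M (λ t → cost t e)) E)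
                                                ≡⟨ cong (λ xs → M ℕ.* 4 ℕ.+ sum xs) (map-cong total E) ⟩
    _                                           ∎
    where
    open ℕ.≤-Reasoning
    corner : ℕ → V → ℤ × ℤ
    corner t v = level (p v) t , level (q v) t
    cost : ℕ → V × V → ℕ
    cost t (u , v) = gridCost (corner t u) (corner t v)
    total : ∀ e → let u , v = e in
            ∑< M (λ t → cost t e) ≡ gridCost (position (p u) , position (q u)) (position (p v) , position (q v))
    total (u , v) = trans (∑<-* M 2 _) (cong (2 ℕ.*_) (trans (∑<-+ M _ _)
      (cong₂ ℕ._+_ (averages (p u) (p v) (p≤M u) (p≤M v)) (averages (q u) (q v) (q≤M u) (q≤M v)))))
    -- The level is `a` or `a + 1`, and `pair` contains the level and its predecessor. This is the
    -- discrete form of the fact that the side-2 square contains the cell.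
    ∈-pair : ∀ a t r → a ∈ pair (a ℤ.+ + below t r)
    ∈-pair a t r with below t r | below-≤1 t r
    ... | 0 | _       = here (sym (ℤ.+-identityʳ a))
    ... | 1 | s≤s z≤n = there (here (sym (trans (cong ℤ.pred (ℤ.+-comm a (+ 1))) (ℤ.pred-suc a))))
    each : ∀ t → length cs ℕ.≤ 4 ℕ.+ sum (map (cost t) E)
    each t = covered-cells _≟_ (corner t) E r cs! λ c∈ → let v , r , eq = covered c∈ in
      v , r , subst (_∈ block (corner t v)) eq
        (∈-cartesianProduct⁺ (∈-pair _ t (proj₂ (p v))) (∈-pair _ t (proj₂ (q v))))

-- Rational estimates

ι : ℤ → ℚ
ι z = z ℚ./ 1

toℚᵘ-/ : ∀ z n → ℚ.toℚᵘ (z ℚ./ suc n) ℚᵘ.≃ mkℚᵘ z n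
toℚᵘ-/ z n = ℚ.toℚᵘ-fromℚᵘ (mkℚᵘ z n)

ι-+ : ∀ a b → ι (a ℤ.+ b) ≡ ι a ℚ.+ ι b
ι-+ a b = ℚ.toℚᵘ-injective (begin
  ℚ.toℚᵘ (ι (a ℤ.+ b))               ≈⟨ toℚᵘ-/ (a ℤ.+ b) 0 ⟩
  mkℚᵘ (a ℤ.+ b) 0                   ≈⟨ *≡* (solve 2 (λ a b → (a :+ b) :* con (+ 1) := (a :* con (+ 1) :+ b :* con (+ 1)) :* con (+ 1)) refl a b) ⟩
  mkℚᵘ a 0 ℚᵘ.+ mkℚᵘ b 0             ≈⟨ ℚᵘ.+-cong (toℚᵘ-/ a 0) (toℚᵘ-/ b 0) ⟨
  ℚ.toℚᵘ (ι a) ℚᵘ.+ ℚ.toℚᵘ (ι b)     ≈⟨ ℚ.toℚᵘ-homo-+ (ι a) (ι b) ⟨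
  ℚ.toℚᵘ (ι a ℚ.+ ι b)               ∎)
  where
  open ℚᵘ.≃-Reasoning
  open ℤ-Solver.+-*-Solver

ι-* : ∀ a b → ι (a ℤ.* b) ≡ ι a ℚ.* ι b
ι-* a b = ℚ.toℚᵘ-injective (begin
  ℚ.toℚᵘ (ι (a ℤ.* b))               ≈⟨ toℚᵘ-/ (a ℤ.* b) 0 ⟩
  mkℚᵘ (a ℤ.* b) 0                   ≈⟨ ℚᵘ.*-cong (toℚᵘ-/ a 0) (toℚᵘ-/ b 0) ⟨
  ℚ.toℚᵘ (ι a) ℚᵘ.* ℚ.toℚᵘ (ι b)     ≈⟨ ℚ.toℚᵘ-homo-* (ι a) (ι b) ⟨
  ℚ.toℚᵘ (ι a ℚ.* ι b)               ∎)
  where open ℚᵘ.≃-Reasoning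

ι-neg : ∀ a → ι (ℤ.- a) ≡ ℚ.- ι a
ι-neg a = ℚ.toℚᵘ-injective (begin
  ℚ.toℚᵘ (ι (ℤ.- a))    ≈⟨ toℚᵘ-/ (ℤ.- a) 0 ⟩
  ℚᵘ.- mkℚᵘ a 0         ≈⟨ ℚᵘ.-‿cong (toℚᵘ-/ a 0) ⟨
  ℚᵘ.- ℚ.toℚᵘ (ι a)     ≈⟨ ℚ.toℚᵘ-homo‿- (ι a) ⟨
  ℚ.toℚᵘ (ℚ.- ι a)      ∎)
  where open ℚᵘ.≃-Reasoning

ι-mono : ∀ {a b} → a ℤ.≤ b → ι a ℚ.≤ ι b
ι-mono {a} {b} a≤b = ℚ.toℚᵘ-cancel-≤ (begin
  ℚ.toℚᵘ (ι a)   ≃⟨ toℚᵘ-/ a 0 ⟩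
  mkℚᵘ a 0       ≤⟨ *≤* (ℤ.*-monoʳ-≤-nonNeg (+ 1) a≤b) ⟩
  mkℚᵘ b 0       ≃⟨ toℚᵘ-/ b 0 ⟨
  ℚ.toℚᵘ (ι b)   ∎)
  where open ℚᵘ.≤-Reasoning

ι-nonNeg : ∀ n → 0ℚ ℚ.≤ ι (+ n)
ι-nonNeg n = ι-mono {+ 0} {+ n} (ℤ.+≤+ z≤n)

ι-∣∣ : ∀ a → ι (+ ∣ a ∣) ≡ ℚ.∣ ι a ∣
ι-∣∣ (+ n)    = sym (ℚ.0≤p⇒∣p∣≡p (ι-nonNeg n))
ι-∣∣ -[1+ n ] = sym (trans (ℚ.∣-p∣≡∣p∣ (ι (+ suc n))) (ℚ.0≤p⇒∣p∣≡p (ι-nonNeg (suc n))))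

ι-pos : ∀ m → ℚ.Positive (ι (+ suc m))
ι-pos m = ℚ.normalize-pos (suc m) 1

ι*-inverse : ∀ m → ι (+ suc m) ℚ.* (1 /suc m) ≡ 1ℚ
ι*-inverse m = ℚ.toℚᵘ-injective (begin
  ℚ.toℚᵘ (ι (+ suc m) ℚ.* (1 /suc m))            ≈⟨ ℚ.toℚᵘ-homo-* (ι (+ suc m)) (1 /suc m) ⟩
  ℚ.toℚᵘ (ι (+ suc m)) ℚᵘ.* ℚ.toℚᵘ (1 /suc m)    ≈⟨ ℚᵘ.*-cong (toℚᵘ-/ (+ suc m) 0) (toℚᵘ-/ (+ 1) m) ⟩
  mkℚᵘ (+ suc m) 0 ℚᵘ.* mkℚᵘ (+ 1) m             ≈⟨ *≡* (solve 1 (λ m → (m :* con (+ 1)) :* con (+ 1) := con (+ 1) :* (con (+ 1) :* m)) refl (+ suc m)) ⟩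
  ℚ.toℚᵘ 1ℚ                                      ∎)
  where
  open ℚᵘ.≃-Reasoning
  open ℤ-Solver.+-*-Solver

/suc-antitone : ∀ {m n} → m ℕ.≤ n → 1 /suc n ℚ.≤ 1 /suc m
/suc-antitone {m} {n} m≤n = ℚ.toℚᵘ-cancel-≤ (begin
  ℚ.toℚᵘ (1 /suc n)   ≃⟨ toℚᵘ-/ (+ 1) n ⟩
  mkℚᵘ (+ 1) n        ≤⟨ *≤* (ℤ.*-monoˡ-≤-nonNeg (+ 1) (ℤ.+≤+ (s≤s m≤n))) ⟩
  mkℚᵘ (+ 1) m        ≃⟨ toℚᵘ-/ (+ 1) m ⟨
  ℚ.toℚᵘ (1 /suc m)   ∎)
  where open ℚᵘ.≤-Reasoning

archimedean : ∀ K ε → 0ℚ ℚ.< ε → ∃ λ m → ι (+ K) ℚ.≤ ι (+ suc m) ℚ.* ε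
archimedean K (mkℚ (+ zero) d _)    ε>0 with ℚ.drop-*<* ε>0
... | ℤ.+<+ ()
archimedean K (mkℚ ℤ.-[1+ k ] d _)  ε>0 with ℚ.drop-*<* ε>0
... | ()
archimedean K ε@(mkℚ ℤ.+[1+ k ] d _) ε>0 = m , ℚ.toℚᵘ-cancel-≤ (begin
    ℚ.toℚᵘ (ι (+ K))                        ≃⟨ toℚᵘ-/ (+ K) 0 ⟩
    mkℚᵘ (+ K) 0                            ≤⟨ *≤* ineq ⟩
    mkℚᵘ (+ suc m) 0 ℚᵘ.* mkℚᵘ (+ suc k) d  ≃⟨ ℚᵘ.*-congʳ {mkℚᵘ (+ suc k) d} (toℚᵘ-/ (+ suc m) 0) ⟨
    ℚ.toℚᵘ (ι (+ suc m)) ℚᵘ.* ℚ.toℚᵘ ε      ≃⟨ ℚ.toℚᵘ-homo-* (ι (+ suc m)) ε ⟨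
    ℚ.toℚᵘ (ι (+ suc m) ℚ.* ε)              ∎)
  where
  open ℚᵘ.≤-Reasoning
  -- `ε` is (k + 1)/(d + 1), hence at least 1/(d + 1), so any factor of at least K(d + 1) is large
  -- enough.
  m = K ℕ.* suc d
  ineq : + K ℤ.* + (1 ℕ.* suc d) ℤ.≤ + (suc m ℕ.* suc k) ℤ.* + 1
  ineq = subst₂ ℤ._≤_ (ℤ.pos-* K (1 ℕ.* suc d)) (ℤ.pos-* (suc m ℕ.* suc k) 1) (ℤ.+≤+ nat)
    where
    nat : K ℕ.* (1 ℕ.* suc d) ℕ.≤ suc m ℕ.* suc k ℕ.* 1
    nat = ℕ.≤-trans (ℕ.≤-reflexive (cong (K ℕ.*_) (ℕ.*-identityˡ (suc d))))
          (ℕ.≤-trans (ℕ.n≤1+n m) (ℕ.≤-trans (ℕ.m≤m*n (suc m) (suc k)) (ℕ.≤-reflexive (sym (ℕ.*-identityʳ _)))))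

∣p-q∣≤ : ∀ {p q r} → p ℚ.≤ q ℚ.+ r → q ℚ.≤ p ℚ.+ r → ℚ.∣ p ℚ.- q ∣ ℚ.≤ r
∣p-q∣≤ {p} {q} {r} p≤ q≤ with ℚ.∣p∣≡p∨∣p∣≡-p (p ℚ.- q)
... | inj₁ eq = begin
    ℚ.∣ p ℚ.- q ∣   ≡⟨ eq ⟩
    p ℚ.- q         ≤⟨ ℚ.+-monoˡ-≤ (ℚ.- q) p≤ ⟩
    q ℚ.+ r ℚ.- q   ≡⟨ solve 2 (λ q r → q :+ r :- q := r) refl q r ⟩
    r               ∎
  where
  open ℚ.≤-Reasoning
  open ℚ-Solver.+-*-Solver
... | inj₂ eq = begin
    ℚ.∣ p ℚ.- q ∣   ≡⟨ eq ⟩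
    ℚ.- (p ℚ.- q)   ≡⟨ solve 2 (λ p q → :- (p :- q) := q :- p) refl p q ⟩
    q ℚ.- p         ≤⟨ ℚ.+-monoˡ-≤ (ℚ.- p) q≤ ⟩
    p ℚ.+ r ℚ.- p   ≡⟨ solve 2 (λ p r → p :+ r :- p := r) refl p r ⟩
    r               ∎
  where
  open ℚ.≤-Reasoning
  open ℚ-Solver.+-*-Solver

-- The unit of slack at both ends allows for a rational approximation that lies slightly outside its
-- cell; clamping to 0, ..., M still moves `g` by at most 1.
round : ∀ M g → 0ℚ ℚ.≤ g ℚ.+ 1ℚ → g ℚ.≤ ι (+ M) ℚ.+ 1ℚ →
        ∃ λ r → r ℕ.≤ M × ℚ.∣ ι (+ r) ℚ.- g ∣ ℚ.≤ 1ℚ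
round zero    g 0≤g+1 g≤1 = 0 , z≤n , ∣p-q∣≤ 0≤g+1 g≤1
round (suc M) g 0≤g+1 g≤M+2 with ℚ.≤-total g (ι (+ M) ℚ.+ 1ℚ)
... | inj₁ g≤M+1 = let r , r≤M , close = round M g 0≤g+1 g≤M+1
                   in r , ℕ.m≤n⇒m≤1+n r≤M , close
... | inj₂ M+1≤g = suc M , ℕ.≤-refl , ∣p-q∣≤ (begin
    ι (+ suc M)        ≡⟨ ι-+ (+ 1) (+ M) ⟩
    1ℚ ℚ.+ ι (+ M)     ≡⟨ ℚ.+-comm 1ℚ (ι (+ M)) ⟩
    ι (+ M) ℚ.+ 1ℚ     ≤⟨ M+1≤g ⟩
    g                  ≡⟨ ℚ.+-identityʳ g ⟨
    g ℚ.+ 0ℚ           ≤⟨ ℚ.+-monoʳ-≤ g (ℚ.nonNegative⁻¹ 1ℚ) ⟩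
    g ℚ.+ 1ℚ           ∎) g≤M+2
  where open ℚ.≤-Reasoning

square-∣∣ : ∀ p → square ℚ.∣ p ∣ ≡ square p
square-∣∣ p with ℚ.∣p∣≡p∨∣p∣≡-p p
... | inj₁ eq = cong square eq
... | inj₂ eq = trans (cong square eq) (solve 1 (λ p → (:- p) :* (:- p) := p :* p) refl p)
  where open ℚ-Solver.+-*-Solver

0≤square : ∀ p → 0ℚ ℚ.≤ square p
0≤square p = subst₂ ℚ._≤_ (ℚ.*-zeroʳ ℚ.∣ p ∣) (square-∣∣ p)
  (ℚ.*-monoˡ-≤-nonNeg ℚ.∣ p ∣ {{ℚ.∣-∣-nonNeg p}} (ℚ.0≤∣p∣ p))

square-mono-≤ : ∀ {p q} → 0ℚ ℚ.≤ p → p ℚ.≤ q → square p ℚ.≤ square q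
square-mono-≤ {p} {q} 0≤p p≤q = ℚ.≤-trans
  (ℚ.*-monoˡ-≤-nonNeg p {{ℚ.nonNegative 0≤p}} p≤q)
  (ℚ.*-monoʳ-≤-nonNeg q {{ℚ.nonNegative (ℚ.≤-trans 0≤p p≤q)}} p≤q)

-- `root` rounds down to a multiple of 1/(n + 1), so one more step of that size has a square
-- exceeding `q`.
∣p∣≤root : ∀ n p {q} → square p ℚ.≤ q → ℚ.∣ p ∣ ℚ.≤ root n q ℚ.+ 1 /suc n
∣p∣≤root n p {q} p²≤q = ℚ.≮⇒≥ λ root<∣p∣ → ℚ.<-irrefl refl (begin-strict
    square ℚ.∣ p ∣                     ≡⟨ square-∣∣ p ⟩
    square p                           ≤⟨ p²≤q ⟩
    q                                  <⟨ root-upper n q ⟩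
    square (root n q ℚ.+ 1 /suc n)     ≤⟨ square-mono-≤ 0≤root (ℚ.<⇒≤ root<∣p∣) ⟩
    square ℚ.∣ p ∣                     ∎)
  where
  open ℚ.≤-Reasoning
  0≤root : 0ℚ ℚ.≤ root n q ℚ.+ 1 /suc n
  0≤root = ℚ.+-mono-≤ (root-nonNeg n q) (ℚ.nonNegative⁻¹ (1 /suc n) {{ℚ.normalize-nonNeg 1 (suc n)}})

-- The GGMST instance

Eventually : (ℕ → Set) → Set
Eventually P = ∃ λ N → ∀ n → N ℕ.≤ n → P n

eventually-× : ∀ {P Q : ℕ → Set} → Eventually P → Eventually Q → Eventually (λ n → P n × Q n)
eventually-× (M , p) (N , q) = M ℕ.⊔ N , λ n n≥ →
  p n (ℕ.m⊔n≤o⇒m≤o M N n≥) , q n (ℕ.m⊔n≤o⇒n≤o M N n≥)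

eventually-Fin : ∀ k {P : Fin k → ℕ → Set} → (∀ i → Eventually (P i)) →
                 Eventually (λ n → ∀ i → P i n)
eventually-Fin zero    p = 0 , λ _ _ ()
eventually-Fin (suc k) p =
  let N , q = eventually-× (p zero) (eventually-Fin k (λ i → p (suc i)))
  in N , λ n n≥ → λ { zero → proj₁ (q n n≥) ; (suc i) → proj₂ (q n n≥) i }

-- Rounding coordinates to multiples of 1/M

module Discretisation (m : ℕ) where

  M = suc m
  μ = ι (+ M)
  -- The tolerance for approximations of reals is tied to the mesh: since `μ` times `δ` is 1, every
  -- error becomes a constant independent of M after scaling.
  δ = 1 /suc m

  private instance
    μ-nonNeg : ℚ.NonNegative μ
    μ-nonNeg = ℚ.nonNegative (ι-nonNeg M)

  approximate : ∀ a x → ι a ℚ.≤ x ℚ.+ δ → x ℚ.≤ ι (ℤ.suc a) ℚ.+ δ →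
                ∃ λ r → r ℕ.≤ M × ℚ.∣ ι (position M (a , r)) ℚ.- μ ℚ.* x ∣ ℚ.≤ 1ℚ
  approximate a x a≤x+δ x≤a+1+δ =
    let r , r≤M , close = round M g 0≤g+1 g≤M+1
    in r , r≤M , ℚ.≤-trans (ℚ.≤-reflexive (cong ℚ.∣_∣ (shifted r))) close
    where
    open ℚ-Solver.+-*-Solver
    -- The offset of `x` inside its cell in units of 1/M. The tolerance `δ` puts it between -1 and M
    -- + 1, as `round` requires.
    g = μ ℚ.* (x ℚ.- ι a)
    shifted : ∀ r → ι (position M (a , r)) ℚ.- μ ℚ.* x ≡ ι (+ r) ℚ.- g
    shifted r = trans
      (cong (ℚ._- μ ℚ.* x) (trans (ι-+ (a ℤ.* + M) (+ r)) (cong (ℚ._+ ι (+ r)) (ι-* a (+ M)))))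
      (solve 4 (λ a μ r x → a :* μ :+ r :- μ :* x := r :- μ :* (x :- a)) refl (ι a) μ (ι (+ r)) x)
    0≤g+1 : 0ℚ ℚ.≤ g ℚ.+ 1ℚ
    0≤g+1 = begin
      0ℚ                              ≡⟨ ℚ.*-zeroʳ μ ⟨
      μ ℚ.* 0ℚ                        ≡⟨ cong (μ ℚ.*_) (ℚ.+-inverseʳ (ι a)) ⟨
      μ ℚ.* (ι a ℚ.- ι a)             ≤⟨ ℚ.*-monoˡ-≤-nonNeg μ (ℚ.+-monoˡ-≤ (ℚ.- ι a) a≤x+δ) ⟩
      μ ℚ.* (x ℚ.+ δ ℚ.- ι a)         ≡⟨ solve 4 (λ μ x δ a → μ :* (x :+ δ :- a) := μ :* (x :- a) :+ μ :* δ) refl μ x δ (ι a) ⟩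
      g ℚ.+ μ ℚ.* δ                   ≡⟨ cong (g ℚ.+_) (ι*-inverse m) ⟩
      g ℚ.+ 1ℚ                        ∎
      where open ℚ.≤-Reasoning
    g≤M+1 : g ℚ.≤ μ ℚ.+ 1ℚ
    g≤M+1 = begin
      g                                       ≤⟨ ℚ.*-monoˡ-≤-nonNeg μ (ℚ.+-monoˡ-≤ (ℚ.- ι a) x≤a+1+δ) ⟩
      μ ℚ.* (ι (ℤ.suc a) ℚ.+ δ ℚ.- ι a)       ≡⟨ cong (λ z → μ ℚ.* (z ℚ.+ δ ℚ.- ι a)) (ι-+ (+ 1) a) ⟩
      μ ℚ.* (1ℚ ℚ.+ ι a ℚ.+ δ ℚ.- ι a)        ≡⟨ solve 4 (λ μ o a δ → μ :* (o :+ a :+ δ :- a) := μ :* o :+ μ :* δ) refl μ 1ℚ (ι a) δ ⟩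
      μ ℚ.* 1ℚ ℚ.+ μ ℚ.* δ                    ≡⟨ cong₂ ℚ._+_ (ℚ.*-identityʳ μ) (ι*-inverse m) ⟩
      μ ℚ.+ 1ℚ                                ∎
      where open ℚ.≤-Reasoning

  -- The 3 consists of one unit for rounding each endpoint and one for the tolerance `δ` in the
  -- length of the edge.
  gap-≤ : ∀ X X′ x x′ {ρ} → ℚ.∣ ι X ℚ.- μ ℚ.* x ∣ ℚ.≤ 1ℚ → ℚ.∣ ι X′ ℚ.- μ ℚ.* x′ ∣ ℚ.≤ 1ℚ →
          ℚ.∣ x ℚ.- x′ ∣ ℚ.≤ ρ ℚ.+ δ →
          ι (+ ∣ X ℤ.- X′ ∣) ℚ.≤ μ ℚ.* ρ ℚ.+ ι (+ 3)
  gap-≤ X X′ x x′ {ρ} X≈ X′≈ x-x′ = begin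
      ι (+ ∣ X ℤ.- X′ ∣)                  ≡⟨ ι-∣∣ (X ℤ.- X′) ⟩
      ℚ.∣ ι (X ℤ.- X′) ∣                  ≡⟨ cong ℚ.∣_∣ split ⟩
      ℚ.∣ A ℚ.- A′ ℚ.+ μ ℚ.* d ∣          ≤⟨ ℚ.∣p+q∣≤∣p∣+∣q∣ (A ℚ.- A′) (μ ℚ.* d) ⟩
      ℚ.∣ A ℚ.- A′ ∣ ℚ.+ ℚ.∣ μ ℚ.* d ∣    ≤⟨ ℚ.+-mono-≤ (ℚ.≤-trans (ℚ.∣p-q∣≤∣p∣+∣q∣ A A′) (ℚ.+-mono-≤ X≈ X′≈)) scaled ⟩
      1ℚ ℚ.+ 1ℚ ℚ.+ (μ ℚ.* ρ ℚ.+ 1ℚ)      ≡⟨ solve 1 (λ z → con 1ℚ :+ con 1ℚ :+ (z :+ con 1ℚ) := z :+ con (ι (+ 3))) refl (μ ℚ.* ρ) ⟩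
      μ ℚ.* ρ ℚ.+ ι (+ 3)                 ∎
    where
    open ℚ.≤-Reasoning
    open ℚ-Solver.+-*-Solver
    d  = x ℚ.- x′
    A  = ι X ℚ.- μ ℚ.* x
    A′ = ι X′ ℚ.- μ ℚ.* x′
    split : ι (X ℤ.- X′) ≡ A ℚ.- A′ ℚ.+ μ ℚ.* d
    split = trans (trans (ι-+ X (ℤ.- X′)) (cong (ι X ℚ.+_) (ι-neg X′)))
      (solve 5 (λ X X′ μ x x′ → X :- X′ := (X :- μ :* x) :- (X′ :- μ :* x′) :+ μ :* (x :- x′)) refl
        (ι X) (ι X′) μ x x′)
    scaled : ℚ.∣ μ ℚ.* d ∣ ℚ.≤ μ ℚ.* ρ ℚ.+ 1ℚ
    scaled = begin
      ℚ.∣ μ ℚ.* d ∣             ≡⟨ ℚ.∣p*q∣≡∣p∣*∣q∣ μ d ⟩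
      ℚ.∣ μ ∣ ℚ.* ℚ.∣ d ∣       ≡⟨ cong (ℚ._* ℚ.∣ d ∣) (ℚ.0≤p⇒∣p∣≡p (ι-nonNeg M)) ⟩
      μ ℚ.* ℚ.∣ d ∣             ≤⟨ ℚ.*-monoˡ-≤-nonNeg μ x-x′ ⟩
      μ ℚ.* (ρ ℚ.+ δ)           ≡⟨ ℚ.*-distribˡ-+ μ ρ δ ⟩
      μ ℚ.* ρ ℚ.+ μ ℚ.* δ       ≡⟨ cong (μ ℚ.* ρ ℚ.+_) (ι*-inverse m) ⟩
      μ ℚ.* ρ ℚ.+ 1ℚ            ∎

  -- ∣Δx∣ and ∣Δy∣ are each at most the length ρ of the edge, whence the factor 4 = 2 · 2.
  gridCost-≤ : ∀ X Y X′ Y′ {ρ} →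
    ι (+ ∣ X ℤ.- X′ ∣) ℚ.≤ μ ℚ.* ρ ℚ.+ ι (+ 3) → ι (+ ∣ Y ℤ.- Y′ ∣) ℚ.≤ μ ℚ.* ρ ℚ.+ ι (+ 3) →
    ι (+ gridCost (X , Y) (X′ , Y′)) ℚ.≤ ι (+ 4) ℚ.* (μ ℚ.* ρ) ℚ.+ ι (+ 12)
  gridCost-≤ X Y X′ Y′ {ρ} ΔX≤ ΔY≤ = begin
      ι (+ (2 ℕ.* (A ℕ.+ B)))                           ≡⟨ cong ι (ℤ.pos-* 2 (A ℕ.+ B)) ⟩
      ι (+ 2 ℤ.* + (A ℕ.+ B))                           ≡⟨ ι-* (+ 2) (+ (A ℕ.+ B)) ⟩
      ι (+ 2) ℚ.* ι (+ (A ℕ.+ B))                       ≡⟨ cong (ι (+ 2) ℚ.*_) (ι-+ (+ A) (+ B)) ⟩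
      ι (+ 2) ℚ.* (ι (+ A) ℚ.+ ι (+ B))                 ≤⟨ ℚ.*-monoˡ-≤-nonNeg (ι (+ 2)) (ℚ.+-mono-≤ ΔX≤ ΔY≤) ⟩
      ι (+ 2) ℚ.* (μ ℚ.* ρ ℚ.+ ι (+ 3) ℚ.+ (μ ℚ.* ρ ℚ.+ ι (+ 3)))
        ≡⟨ solve 1 (λ z → con (ι (+ 2)) :* (z :+ con (ι (+ 3)) :+ (z :+ con (ι (+ 3))))
                            := con (ι (+ 4)) :* z :+ con (ι (+ 12))) refl (μ ℚ.* ρ) ⟩
      ι (+ 4) ℚ.* (μ ℚ.* ρ) ℚ.+ ι (+ 12)                ∎
    where
    open ℚ.≤-Reasoning
    open ℚ-Solver.+-*-Solver
    A = ∣ X ℤ.- X′ ∣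
    B = ∣ Y ℤ.- Y′ ∣

-- Addition of reals is termwise, so the weight at index `n` is the sum of the edge lengths at index
-- `n`. The rounding error is 12 per edge, whatever `μ` is, and becomes negligible after division by
-- a large `μ`.
sum-cost-≤ : ∀ {E : Set} (cost : E → ℕ) (d : E → ℝ) n μ →
  (∀ e → ι (+ cost e) ℚ.≤ ι (+ 4) ℚ.* (μ ℚ.* seq (d e) n) ℚ.+ ι (+ 12)) →
  ∀ es → ι (+ sum (map cost es)) ℚ.≤
         μ ℚ.* (ι (+ 4) ℚ.* seq (foldr _+_ (fromℕ 0) (map d es)) n) ℚ.+ ι (+ (length es ℕ.* 12))
sum-cost-≤ cost d n μ cost≤ [] = ℚ.≤-reflexive
  (solve 1 (λ μ → con 0ℚ := μ :* (con (ι (+ 4)) :* con 0ℚ) :+ con 0ℚ) refl μ)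
  where open ℚ-Solver.+-*-Solver
sum-cost-≤ cost d n μ cost≤ (e ∷ es) = begin
    ι (+ (cost e ℕ.+ sum (map cost es)))                 ≡⟨ ι-+ (+ cost e) (+ sum (map cost es)) ⟩
    ι (+ cost e) ℚ.+ ι (+ sum (map cost es))             ≤⟨ ℚ.+-mono-≤ (cost≤ e) (sum-cost-≤ cost d n μ cost≤ es) ⟩
    ι (+ 4) ℚ.* (μ ℚ.* ρ) ℚ.+ ι (+ 12) ℚ.+ (μ ℚ.* (ι (+ 4) ℚ.* W) ℚ.+ ι (+ (length es ℕ.* 12)))
      ≡⟨ solve 6 (λ f μ ρ t W l → f :* (μ :* ρ) :+ t :+ (μ :* (f :* W) :+ l)
                                    := μ :* (f :* (ρ :+ W)) :+ (t :+ l)) refl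
           (ι (+ 4)) μ ρ (ι (+ 12)) W (ι (+ (length es ℕ.* 12))) ⟩
    μ ℚ.* (ι (+ 4) ℚ.* (ρ ℚ.+ W)) ℚ.+ (ι (+ 12) ℚ.+ ι (+ (length es ℕ.* 12)))
      ≡⟨ cong (μ ℚ.* (ι (+ 4) ℚ.* (ρ ℚ.+ W)) ℚ.+_) (ι-+ (+ 12) (+ (length es ℕ.* 12))) ⟨
    μ ℚ.* (ι (+ 4) ℚ.* (ρ ℚ.+ W)) ℚ.+ ι (+ (length (e ∷ es) ℕ.* 12)) ∎
  where
  open ℚ.≤-Reasoning
  open ℚ-Solver.+-*-Solver
  ρ = seq (d e) n
  W = seq (foldr _+_ (fromℕ 0) (map d es)) n

-- Each of the two squares is at most their sum, and the root taken at index `n` falls short by at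
-- most 1/(n + 1), hence by at most 1/(m + 1).
distance-≥ : ∀ {m} n → m ℕ.≤ n → ∀ p q → let ρ = seq (distance p q) n in
  ℚ.∣ seq (proj₁ p) n ℚ.- seq (proj₁ q) n ∣ ℚ.≤ ρ ℚ.+ 1 /suc m ×
  ℚ.∣ seq (proj₂ p) n ℚ.- seq (proj₂ q) n ∣ ℚ.≤ ρ ℚ.+ 1 /suc m
distance-≥ {m} n m≤n (x , y) (x′ , y′) =
    bound dx (ℚ.≤-trans (ℚ.≤-reflexive (sym (ℚ.+-identityʳ (square dx))))
               (ℚ.+-monoʳ-≤ (square dx) (0≤square dy)))
  , bound dy (ℚ.≤-trans (ℚ.≤-reflexive (sym (ℚ.+-identityˡ (square dy))))
               (ℚ.+-monoˡ-≤ (square dy) (0≤square dx)))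
  where
  dx = seq x n ℚ.- seq x′ n
  dy = seq y n ℚ.- seq y′ n
  q  = square dx ℚ.+ square dy
  bound : ∀ p → square p ℚ.≤ q → ℚ.∣ p ∣ ℚ.≤ root n (q ℚ.⊔ 0ℚ) ℚ.+ 1 /suc m
  bound p p²≤q = ℚ.≤-trans (∣p∣≤root n p (ℚ.≤-trans p²≤q (ℚ.p≤p⊔q q 0ℚ)))
    (ℚ.+-monoʳ-≤ (root n (q ℚ.⊔ 0ℚ)) (/suc-antitone m≤n))

-- Reaching every non-empty cell through the tree

module _ {n} (G : Graph n) where
  open Graph G

  -- `edges` keeps a pair only with its smaller endpoint first, so the order of `i` and `j` decides
  -- the direction of traversal.
  Adjacent⇒Reached : ∀ {R i j} → Adjacent i j → Reached edges R i → Reached edges R j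
  Adjacent⇒Reached {i = i} {j} adj r with Fin.<-cmp i j
  ... | tri< i<j _ _ = forth (∈-filter⁺ _ (∈-cartesianProduct⁺ (∈-allFin i) (∈-allFin j)) (i<j , adj)) r
  ... | tri≈ _ i≡j _ = ⊥-elim (loopless i≡j adj)
  ... | tri> _ _ j<i = back (∈-filter⁺ _ (∈-cartesianProduct⁺ (∈-allFin j) (∈-allFin i)) (j<i , symmetric adj)) r

  Star⇒Reached : ∀ {R i j} → Star Adjacent i j → Reached edges R i → Reached edges R j
  Star⇒Reached nil      r = r
  Star⇒Reached (a ◅ as) r = Star⇒Reached as (Adjacent⇒Reached a r)

module _ (I : Instance) (T : Graph (Instance.size I)) (feasible : IsFeasible I T) where
  open Instance I
  open Graph T

  ∈-nonEmptyCells⇒vertex : ∀ {c} → c ∈ nonEmptyCells → ∃ λ i → i Subset.∈ vertices × cell i ≡ c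
  ∈-nonEmptyCells⇒vertex {c} c∈ =
    let i , _ , c≡ = ∈-map⁻ cell (∈-deduplicate⁻ _≟ᶜ_ (map cell (allFin size)) c∈)
        j , j∈ , _ = proj₂ feasible c (i , sym c≡)
    in j , j∈

  -- The root is the tree vertex in the first listed cell. Every other cell also has a tree vertex,
  -- and connectedness supplies the walk to it.
  nonEmptyCells-reached : ∃ λ r → ∀ {c} → c ∈ nonEmptyCells →
                          ∃ λ i → Reached edges [ r ] i × cell i ≡ c
  nonEmptyCells-reached with nonEmptyCells | ∈-nonEmptyCells⇒vertex
  -- With no cells to reach, any index serves as the root; one exists because the instance is
  -- non-empty.
  ... | []     | _      = Fin.fromℕ< (ℕ.>-nonZero⁻¹ size {{nonEmpty}}) , λ ()
  ... | c ∷ cs | vertex =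
    let r , r∈ , _ = vertex (here refl)
    in r , λ c∈ → let i , i∈ , eq = vertex c∈
                  in i , Star⇒Reached T (proj₁ (proj₁ feasible) r∈ i∈) (start (here refl)) , eq

-- The estimate at a fixed mesh

module _ (I : Instance) where
  open Instance I

  -- Inequality between reals only bounds late terms up to a positive error, so at index `n` a point
  -- is known to lie in its cell only up to `δ`.
  NearCell : ℕ → ℕ → Fin size → Set
  NearCell m n i =
    let (x , y) = point i
        (a , b) = cell i
        δ       = 1 /suc m
    in (ι a ℚ.≤ seq x n ℚ.+ δ × seq x n ℚ.≤ ι (ℤ.suc a) ℚ.+ δ)
     × (ι b ℚ.≤ seq y n ℚ.+ δ × seq y n ℚ.≤ ι (ℤ.suc b) ℚ.+ δ)

  eventually-nearCell : ∀ m → Eventually (λ n → ∀ i → NearCell m n i)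
  eventually-nearCell m = eventually-Fin size λ i →
    let (a≤x , x≤a+1) , (b≤y , y≤b+1) = contains i
    in eventually-×
         (eventually-× (a≤x δ δ>0) (x≤a+1 δ δ>0))
         (eventually-× (b≤y δ δ>0) (y≤b+1 δ δ>0))
    where
    δ   = 1 /suc m
    δ>0 = ℚ.positive⁻¹ δ {{ℚ.normalize-pos 1 (suc m)}}

  -- The number of cells is at most 4 + 4W plus a rounding error, all scaled by M. The error term
  -- depends on the number of edges but not on `m` or `n`.
  cells-weight-≤ : ∀ T → IsFeasible I T → ∀ m n → m ℕ.≤ n → (∀ i → NearCell m n i) →
    ι (+ suc m) ℚ.* ι (+ length nonEmptyCells) ℚ.≤
      ι (+ suc m) ℚ.* (ι (+ 4) ℚ.+ ι (+ 4) ℚ.* seq (weight I T) n)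
        ℚ.+ ι (+ (length (Graph.edges T) ℕ.* 12))
  cells-weight-≤ T feasible m n m≤n near = begin
      μ ℚ.* ι (+ length nonEmptyCells)           ≡⟨ ι-* (+ suc m) (+ length nonEmptyCells) ⟨
      ι (+ suc m ℤ.* + length nonEmptyCells)      ≡⟨ cong ι (ℤ.pos-* (suc m) (length nonEmptyCells)) ⟨
      ι (+ (suc m ℕ.* length nonEmptyCells))      ≤⟨ ι-mono (ℤ.+≤+ counted) ⟩
      ι (+ (suc m ℕ.* 4 ℕ.+ S))                   ≡⟨ ι-+ (+ (suc m ℕ.* 4)) (+ S) ⟩
      ι (+ (suc m ℕ.* 4)) ℚ.+ ι (+ S)             ≡⟨ cong (ℚ._+ ι (+ S)) (trans (cong ι (ℤ.pos-* (suc m) 4)) (ι-* (+ suc m) (+ 4))) ⟩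
      μ ℚ.* ι (+ 4) ℚ.+ ι (+ S)                  ≤⟨ ℚ.+-monoʳ-≤ (μ ℚ.* ι (+ 4)) (sum-cost-≤ cost dist n μ cost≤ edges) ⟩
      μ ℚ.* ι (+ 4) ℚ.+ (μ ℚ.* (ι (+ 4) ℚ.* W) ℚ.+ L)
        ≡⟨ solve 4 (λ μ f W l → μ :* f :+ (μ :* (f :* W) :+ l) := μ :* (f :+ f :* W) :+ l) refl μ (ι (+ 4)) W L ⟩
      μ ℚ.* (ι (+ 4) ℚ.+ ι (+ 4) ℚ.* W) ℚ.+ L    ∎
    where
    open ℚ.≤-Reasoning
    open ℚ-Solver.+-*-Solver
    open Graph T using (edges)
    open Discretisation m using (μ; approximate; gap-≤; gridCost-≤)
    W  = seq (weight I T) n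
    L  = ι (+ (length edges ℕ.* 12))
    x y : Fin size → ℚ
    x i = seq (proj₁ (point i)) n
    y i = seq (proj₂ (point i)) n
    round-x : ∀ i → _
    round-x i = approximate (proj₁ (cell i)) (x i) (proj₁ (proj₁ (near i))) (proj₂ (proj₁ (near i)))
    round-y : ∀ i → _
    round-y i = approximate (proj₂ (cell i)) (y i) (proj₁ (proj₂ (near i))) (proj₂ (proj₂ (near i)))
    p q : Fin size → ℤ × ℕ
    p i = proj₁ (cell i) , proj₁ (round-x i)
    q i = proj₂ (cell i) , proj₁ (round-y i)
    X Y : Fin size → ℤ
    X i = position (suc m) (p i)
    Y i = position (suc m) (q i)
    cost : Fin size × Fin size → ℕ
    cost (i , j) = gridCost (X i , Y i) (X j , Y j)
    dist : Fin size × Fin size → ℝ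
    dist (i , j) = distance (point i) (point j)
    S = sum (map cost edges)
    cost≤ : ∀ e → ι (+ cost e) ℚ.≤ ι (+ 4) ℚ.* (μ ℚ.* seq (dist e) n) ℚ.+ ι (+ 12)
    cost≤ (i , j) =
      let dx≤ , dy≤ = distance-≥ n m≤n (point i) (point j)
      in gridCost-≤ (X i) (Y i) (X j) (Y j)
           (gap-≤ (X i) (X j) (x i) (x j) (proj₂ (proj₂ (round-x i))) (proj₂ (proj₂ (round-x j))) dx≤)
           (gap-≤ (Y i) (Y j) (y i) (y j) (proj₂ (proj₂ (round-y i))) (proj₂ (proj₂ (round-y j))) dy≤)
    counted : suc m ℕ.* length nonEmptyCells ℕ.≤ suc m ℕ.* 4 ℕ.+ S
    counted =
      let r , reached = nonEmptyCells-reached I T feasible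
      in average-cells (suc m) Fin._≟_ p q
           (λ i → proj₁ (proj₂ (round-x i))) (λ i → proj₁ (proj₂ (round-y i)))
           edges r (deduplicate-! (map cell (allFin size))) reached

-- Letting M tend to infinity

theorem2 : (I : Instance) (N : ℕ) (T : Graph (Instance.size I)) →
    length (Instance.nonEmptyCells I) ≡ suc N →
    IsOptimal I T →
    fromℕ N ≤ fromℕ 4 * weight I T + fromℕ 3
theorem2 I N T ∣cells∣≡1+N (feasible , _) ε ε>0 = m ℕ.⊔ n₀ , λ n n≥ →
    let W   = seq (weight I T) n
        bound = cells-weight-≤ I T feasible m n (ℕ.m⊔n≤o⇒m≤o m n₀ n≥)
                  (near n (ℕ.m⊔n≤o⇒n≤o m n₀ n≥))
    in conclude W (subst (λ k → μ ℚ.* ι (+ k) ℚ.≤ μ ℚ.* (ι (+ 4) ℚ.+ ι (+ 4) ℚ.* W) ℚ.+ L)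
                    ∣cells∣≡1+N bound)
  where
  open ℚ-Solver.+-*-Solver
  K = length (Graph.edges T) ℕ.* 12
  L = ι (+ K)
  -- The mesh is fixed first, fine enough for the total rounding error `L` to be at most `μ` times
  -- `ε`. Only then is the index taken, beyond `m` and beyond the point where all approximations are
  -- near their cells.
  m = proj₁ (archimedean K ε ε>0)
  L≤με = proj₂ (archimedean K ε ε>0)
  n₀ = proj₁ (eventually-nearCell I m)
  near = proj₂ (eventually-nearCell I m)
  open Discretisation m using (μ)
  -- Cancelling `μ` turns the rounding error into at most `ε`; passing from N + 1 cells to N turns
  -- the 4 of the first square into 3.
  conclude : ∀ W → μ ℚ.* ι (+ suc N) ℚ.≤ μ ℚ.* (ι (+ 4) ℚ.+ ι (+ 4) ℚ.* W) ℚ.+ L →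
             ι (+ N) ℚ.≤ ι (+ 4) ℚ.* W ℚ.+ ι (+ 3) ℚ.+ ε
  conclude W h = begin
      ι (+ N)                                       ≡⟨ solve 1 (λ z → z := con 1ℚ :+ z :- con 1ℚ) refl (ι (+ N)) ⟩
      1ℚ ℚ.+ ι (+ N) ℚ.- 1ℚ                         ≡⟨ cong (ℚ._- 1ℚ) (ι-+ (+ 1) (+ N)) ⟨
      ι (+ suc N) ℚ.- 1ℚ                            ≤⟨ ℚ.+-monoˡ-≤ (ℚ.- 1ℚ) (ℚ.*-cancelˡ-≤-pos μ {{ι-pos m}} scaled) ⟩
      ι (+ 4) ℚ.+ ι (+ 4) ℚ.* W ℚ.+ ε ℚ.- 1ℚ        ≡⟨ solve 2 (λ W ε → con (ι (+ 4)) :+ con (ι (+ 4)) :* W :+ ε :- con 1ℚ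
                                                          := con (ι (+ 4)) :* W :+ con (ι (+ 3)) :+ ε) refl W ε ⟩
      ι (+ 4) ℚ.* W ℚ.+ ι (+ 3) ℚ.+ ε               ∎
    where
    open ℚ.≤-Reasoning
    scaled : μ ℚ.* ι (+ suc N) ℚ.≤ μ ℚ.* (ι (+ 4) ℚ.+ ι (+ 4) ℚ.* W ℚ.+ ε)
    scaled = begin
      μ ℚ.* ι (+ suc N)                                  ≤⟨ h ⟩
      μ ℚ.* (ι (+ 4) ℚ.+ ι (+ 4) ℚ.* W) ℚ.+ L            ≤⟨ ℚ.+-monoʳ-≤ (μ ℚ.* (ι (+ 4) ℚ.+ ι (+ 4) ℚ.* W)) L≤με ⟩
      μ ℚ.* (ι (+ 4) ℚ.+ ι (+ 4) ℚ.* W) ℚ.+ μ ℚ.* ε     ≡⟨ ℚ.*-distribˡ-+ μ (ι (+ 4) ℚ.+ ι (+ 4) ℚ.* W) ε ⟨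
      μ ℚ.* (ι (+ 4) ℚ.+ ι (+ 4) ℚ.* W ℚ.+ ε)            ∎
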